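{- Let $T$ be a tree on $n$ vertices. Then $\gamma_{LD}(T)=\frac{n+\ell(T)-s(T)-sl(T)}{2}$ if and only if $T\in\mathcal{T}_{SL}$.
   Context: For an undirected graph $G=(V,E)$, $S\subseteq V$ is a locating-dominating set if every $u\notin S$ has $N(u)\cap S\neq\emptyset$ and distinct $u,v\notin S$ satisfy $N(u)\cap S\neq N(v)\cap S$; $\gamma_{LD}(G)$ is the minimum size. A leaf is a vertex of degree 1; a support vertex is a vertex adjacent to a leaf; a support link is a vertex that is neither a leaf nor a support vertex and all of whose neighbours are support vertices. $\ell(T)$, $s(T)$, $sl(T)$ denote the numbers of leaves, support vertices and support links of $T$; $S(T)$ is the set of support vertices. By convention, for the path $P_2$ one vertex is a support vertex and the other a leaf. Let $\mathcal{T}$ be the family of trees $T$ such that either $T=P_2$ or $\gamma_{LD}(T)=\frac{|V(T)|+\ell(T)-s(T)}{2}$. For trees $T_1,\dots,T_k$ with $k\geq 2$, the tree $\mathcal{SL}(T_1,\dots,T_k)$ is obtained from the disjoint union of $T_1,\dots,T_k$ by adding a new vertex $w$ and edges $v_iw$ for chosen vertices $v_i\in S(T_i)$, $1\leq i\leq k$. $\mathcal{T}_{SL}$ is the closure of $\mathcal{T}$ under this operation $\mathcal{SL}$ (the smallest family containing $\mathcal{T}$ and closed under $\mathcal{SL}$). -}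

module Defs where

open import Data.Nat using (ℕ; zero; suc; _+_; _*_; _≤_; _<ᵇ_; _≡ᵇ_)
open import Data.Fin using (Fin; zero; suc; toℕ; inject₁; fromℕ; splitAt)
open import Data.Bool using (Bool; true; false; _∧_; _∨_; not; if_then_else_)
open import Data.Sum using (_⊎_; inj₁; inj₂)
open import Data.Product using (Σ; ∃; _×_; _,_)
open import Relation.Binary.PropositionalEquality using (_≡_; _≢_)
open import Function.Base using (_∘_)
open import Function.Definitions using (Injective)
open import Data.Empty using (⊥)

-- Finite (simple, undirected) graphs on vertex set Fin n, given by a
-- Boolean adjacency function.  Symmetry / irreflexivity are part of
-- the predicate IsTree below.

record Graph : Set where
  constructor mkGraph
  field
    size : ℕ
    adj  : Fin size → Fin size → Bool
open Graph public

count : ∀ {n} → (Fin n → Bool) → ℕ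
count {zero}  f = 0
count {suc n} f = (if f zero then 1 else 0) + count (f ∘ suc)

anyB : ∀ {n} → (Fin n → Bool) → Bool
anyB {zero}  f = false
anyB {suc n} f = f zero ∨ anyB (f ∘ suc)

allB : ∀ {n} → (Fin n → Bool) → Bool
allB {zero}  f = true
allB {suc n} f = f zero ∧ allB (f ∘ suc)

data Walk (G : Graph) : Fin (size G) → Fin (size G) → Set where
  here : ∀ {u} → Walk G u u
  step : ∀ {u w v} → adj G u w ≡ true → Walk G w v → Walk G u v

record Cycle (G : Graph) : Set where
  field
    m      : ℕ
    c      : Fin (suc (suc (suc m))) → Fin (size G)
    inj    : Injective _≡_ _≡_ c
    cons   : ∀ (i : Fin (suc (suc m))) → adj G (c (inject₁ i)) (c (suc i)) ≡ true
    close  : adj G (c (fromℕ (suc (suc m)))) (c zero) ≡ true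

record IsTree (G : Graph) : Set where
  field
    symm      : ∀ u v → adj G u v ≡ adj G v u
    irrefl    : ∀ v → adj G v v ≡ false
    nonempty  : 1 ≤ size G
    connected : ∀ u v → Walk G u v
    acyclic   : Cycle G → ⊥

module _ (G : Graph) where
  deg : Fin (size G) → ℕ
  deg v = count (adj G v)

  -- leaf: degree 1.  Convention for P₂ (a component consisting of two
  -- adjacent degree-1 vertices): the vertex with smaller index is the
  -- support vertex, the other one the leaf.
  isLeaf : Fin (size G) → Bool
  isLeaf v = (deg v ≡ᵇ 1) ∧
             allB (λ u → not (adj G v u ∧ (deg u ≡ᵇ 1)) ∨ (toℕ u <ᵇ toℕ v))

  isSupport : Fin (size G) → Bool
  isSupport v = anyB (λ u → adj G v u ∧ isLeaf u)

  isSupportLink : Fin (size G) → Bool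
  isSupportLink v = not (isLeaf v) ∧ not (isSupport v) ∧
                    allB (λ u → not (adj G v u) ∨ isSupport u)

  ℓ : ℕ
  ℓ = count isLeaf

  s : ℕ
  s = count isSupport

  sl : ℕ
  sl = count isSupportLink

record IsLD (G : Graph) (S : Fin (size G) → Bool) : Set where
  field
    dominating : ∀ u → S u ≡ false → ∃ λ w → S w ≡ true × adj G u w ≡ true
    locating   : ∀ u v → S u ≡ false → S v ≡ false → u ≢ v →
                 ∃ λ w → S w ≡ true × adj G u w ≢ adj G v w

record IsγLD (G : Graph) (k : ℕ) : Set where
  field
    witness   : Σ (Fin (size G) → Bool) λ S → IsLD G S × count S ≡ k
    minimal   : ∀ S → IsLD G S → k ≤ count S

record Iso (G H : Graph) : Set where
  field
    to     : Fin (size G) → Fin (size H)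
    from   : Fin (size H) → Fin (size G)
    from∘to : ∀ x → from (to x) ≡ x
    to∘from : ∀ y → to (from y) ≡ y
    pres   : ∀ u v → adj H (to u) (to v) ≡ adj G u v

-- The family 𝒯: T = P₂ or 2 γ_LD(T) = n + ℓ(T) − s(T).
-- (Written additively, 2γ + s = n + ℓ, avoiding truncated subtraction.)
-- A tree on two vertices is P₂.

InFamilyT : Graph → Set
InFamilyT T = IsTree T ×
  (size T ≡ 2 ⊎ Σ ℕ λ k → IsγLD T k × 2 * k + s T ≡ size T + ℓ T)

-- The operation 𝒮ℒ(T₁,…,T_k) with chosen vertices v_i.
-- Built by successively gluing components to a central vertex w = zero.

isZero : ∀ {n} → Fin n → Bool
isZero zero    = true
isZero (suc _) = false

_==F_ : ∀ {n} → Fin n → Fin n → Bool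
a ==F b = toℕ a ≡ᵇ toℕ b

attach : (H : Graph) → (G : Graph) → Fin (size G) → Graph
attach H G v = mkGraph (size H + size G) A
  where
  A : Fin (size H + size G) → Fin (size H + size G) → Bool
  A x y with splitAt (size H) x | splitAt (size H) y
  ... | inj₁ a | inj₁ b = adj H a b
  ... | inj₂ a | inj₂ b = adj G a b
  ... | inj₁ a | inj₂ b = isZero a ∧ (b ==F v)
  ... | inj₂ a | inj₁ b = isZero b ∧ (a ==F v)

K₁ : Graph
K₁ = mkGraph 1 (λ _ _ → false)

SL : (k : ℕ) (Ts : Fin k → Graph) (vs : (i : Fin k) → Fin (size (Ts i))) → Graph
SL zero    Ts vs = K₁
SL (suc k) Ts vs = attach (SL k (Ts ∘ suc) (vs ∘ suc)) (Ts zero) (vs zero)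

data InTSL : Graph → Set where
  base : ∀ {T} → InFamilyT T → InTSL T
  sl-step : ∀ {T} (k : ℕ) → 2 ≤ k →
            (Ts : Fin k → Graph) (vs : (i : Fin k) → Fin (size (Ts i))) →
            (∀ i → InTSL (Ts i)) →
            (∀ i → isSupport (Ts i) (vs i) ≡ true) →
            Iso (SL k Ts vs) T → InTSL T

{-# OPTIONS --safe #-}

-- Every tree with at least two vertices satisfies 2γ + s + sl ≤ n + ℓ: choose one leaf at each
-- support vertex, all support links, and one colour class (in a proper 2-colouring) of the
-- vertices that are none of leaf, support vertex or support link. These vertices are independent,
-- and two of them never have the same neighbourhood since a tree has no 4-cycle, so the complement
-- is locating-dominating; averaging over the two colours gives the bound. A tree is therefore
-- extremal iff it is "tight": n + ℓ ≤ 2|S| + s + sl for every locating-dominating set S.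
--
-- A locating-dominating set can be changed, without growing, so as to contain prescribed support
-- vertices. Such sets split along, and glue across, the operation SL, while n, ℓ and s add up and
-- the new vertex increases n and sl by one. Hence SL(T₁,…,T_k) is tight iff all T_i are. Finally a
-- tight tree without support links is in 𝒯, and one with a support link w is an SL with centre w.

module Submission where

open import Defs
open import Data.Bool using (Bool; true; false; _∧_; _∨_; not; if_then_else_)
open import Data.Bool.Properties using (¬-not) renaming (_≟_ to _≟ᵇ_)
open import Data.Empty using (⊥; ⊥-elim)
open import Data.Fin using (Fin; zero; suc; toℕ; inject₁; fromℕ; fromℕ<; _↑ˡ_; _↑ʳ_; splitAt)
open import Data.Fin.Properties using (_≟_; any?; suc-injective; toℕ-injective; toℕ<n; injective⇒≤;
  splitAt-↑ˡ; splitAt-↑ʳ; splitAt⁻¹-↑ˡ; splitAt⁻¹-↑ʳ; ↑ˡ-injective; ↑ʳ-injective)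
open import Data.Nat using (ℕ; zero; suc; pred; _+_; _*_; _≤_; _<_; z≤n; s≤s; z<s; _≡ᵇ_; _≤ᵇ_)
open import Data.Nat.Properties as ℕ using (+-mono-≤; ≤-antisym; ≡ᵇ⇒≡; ≡⇒≡ᵇ; <ᵇ⇒<; <⇒<ᵇ; +-*-semiring)
open import Data.Nat.Tactic.RingSolver using (solve-∀)
open import Algebra.Properties.Semiring.Sum +-*-semiring using (sum; sum-cong-≗; ∑-distrib-+; *-distribˡ-sum)
open import Data.Product using (Σ; ∃; ∃₂; _×_; _,_; proj₁; proj₂)
open import Data.Sum using (_⊎_; inj₁; inj₂)
open import Data.Unit using (tt)
open import Function.Base using (_∘_; case_of_)
open import Function.Bundles using (_⇔_; mk⇔)
open import Function.Definitions using (Injective)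
open import Relation.Binary using (tri<; tri≈; tri>)
open import Relation.Binary.PropositionalEquality
  using (_≡_; _≢_; refl; sym; trans; cong; cong₂; subst; subst₂; module ≡-Reasoning)
open import Relation.Nullary using (Dec; yes; no; ¬_)
open import Relation.Nullary.Decidable using (¬?; _×-dec_; decidable-stable)

-- Booleans and counting

clash : ∀ {a} {A : Set a} {b : Bool} → b ≡ true → b ≡ false → A
clash refl ()

iff⇒≡ : ∀ {a b : Bool} → (a ≡ true → b ≡ true) → (b ≡ true → a ≡ true) → a ≡ b
iff⇒≡ {true}  {b}     f g = sym (f refl)
iff⇒≡ {false} {true}  f g = g refl
iff⇒≡ {false} {false} f g = refl

∧⁻ : ∀ {a b} → a ∧ b ≡ true → a ≡ true × b ≡ true
∧⁻ {true} p = refl , p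

∧⁺ : ∀ {a b} → a ≡ true → b ≡ true → a ∧ b ≡ true
∧⁺ refl p = p

∨⁻ : ∀ {a b} → a ∨ b ≡ true → a ≡ true ⊎ b ≡ true
∨⁻ {true}  p = inj₁ refl
∨⁻ {false} p = inj₂ p

∨⁺ˡ : ∀ {a b} → a ≡ true → a ∨ b ≡ true
∨⁺ˡ refl = refl

∨⁺ʳ : ∀ {a b} → b ≡ true → a ∨ b ≡ true
∨⁺ʳ {true}  p = refl
∨⁺ʳ {false} p = p

not⁻ : ∀ {a} → not a ≡ true → a ≡ false
not⁻ {false} p = refl

not⁺ : ∀ {a} → a ≡ false → not a ≡ true
not⁺ refl = refl

imp⁺ : ∀ {a b} → (a ≡ true → b ≡ true) → not a ∨ b ≡ true
imp⁺ {true}  f = f refl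
imp⁺ {false} f = refl

imp⁻ : ∀ {a b} → not a ∨ b ≡ true → a ≡ true → b ≡ true
imp⁻ p refl = p

anyB⁺ : ∀ {n} (f : Fin n → Bool) x → f x ≡ true → anyB f ≡ true
anyB⁺ f zero    p = ∨⁺ˡ p
anyB⁺ f (suc x) p = ∨⁺ʳ {f zero} (anyB⁺ (f ∘ suc) x p)

anyB⁻ : ∀ {n} (f : Fin n → Bool) → anyB f ≡ true → ∃ λ x → f x ≡ true
anyB⁻ {suc n} f p with ∨⁻ {f zero} p
... | inj₁ q = zero , q
... | inj₂ q with anyB⁻ (f ∘ suc) q
...   | x , r = suc x , r

allB⁺ : ∀ {n} (f : Fin n → Bool) → (∀ x → f x ≡ true) → allB f ≡ true
allB⁺ {zero}  f p = refl
allB⁺ {suc n} f p = ∧⁺ (p zero) (allB⁺ (f ∘ suc) (p ∘ suc))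

allB⁻ : ∀ {n} (f : Fin n → Bool) → allB f ≡ true → ∀ x → f x ≡ true
allB⁻ f p zero    = proj₁ (∧⁻ p)
allB⁻ f p (suc x) = allB⁻ (f ∘ suc) (proj₂ (∧⁻ {f zero} p)) x

T⇒≡ : ∀ {b} → Data.Bool.T b → b ≡ true
T⇒≡ {true} _ = refl

≡⇒T : ∀ {b} → b ≡ true → Data.Bool.T b
≡⇒T refl = tt

==F⁻ : ∀ {n} {x y : Fin n} → x ==F y ≡ true → x ≡ y
==F⁻ {x = x} {y} p = toℕ-injective (≡ᵇ⇒≡ (toℕ x) (toℕ y) (≡⇒T p))

==F-refl : ∀ {n} (x : Fin n) → x ==F x ≡ true
==F-refl x = T⇒≡ (≡⇒≡ᵇ (toℕ x) (toℕ x) refl)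

==F-≢ : ∀ {n} {x y : Fin n} → x ≢ y → x ==F y ≡ false
==F-≢ x≢y = ¬-not (x≢y ∘ ==F⁻)

-- The satisfying positions are indexed by `Fin (count f)` itself, so comparing counts reduces to
-- the pigeonhole principle. The same listing later numbers the neighbours of a vertex and the
-- vertices of a branch.
enum : ∀ {n} (f : Fin n → Bool) → Σ (Fin (count f) → Fin n) λ e →
       (∀ i → f (e i) ≡ true) × (∀ i j → e i ≡ e j → i ≡ j) × (∀ x → f x ≡ true → ∃ λ i → e i ≡ x)
enum {zero}  f = (λ ()) , (λ ()) , (λ ()) , (λ ())
enum {suc n} f with f zero in eq | enum (f ∘ suc)
... | true | e , sat , inj , sur =
      (λ { zero → zero ; (suc i) → suc (e i) })
    , (λ { zero → eq ; (suc i) → sat i })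
    , (λ { zero zero _ → refl ; (suc i) (suc j) p → cong suc (inj i j (suc-injective p)) })
    , (λ { zero _ → zero , refl ; (suc x) p → suc (proj₁ (sur x p)) , cong suc (proj₂ (sur x p)) })
... | false | e , sat , inj , sur =
      (λ i → suc (e i))
    , sat
    , (λ i j p → inj i j (suc-injective p))
    , (λ { zero p → clash p eq ; (suc x) p → proj₁ (sur x p) , cong suc (proj₂ (sur x p)) })

count-inj-≤ : ∀ {m n} (f : Fin m → Bool) (g : Fin n → Bool) (φ : Fin m → Fin n) →
  (∀ x → f x ≡ true → g (φ x) ≡ true) →
  (∀ x y → f x ≡ true → f y ≡ true → φ x ≡ φ y → x ≡ y) → count f ≤ count g
count-inj-≤ f g φ sat inj with enum f | enum g
... | e , e-sat , e-inj , _ | e′ , _ , _ , e′-sur = injective⇒≤ {f = index} index-inj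
  where
  found : ∀ i → ∃ λ j → e′ j ≡ φ (e i)
  found i = e′-sur (φ (e i)) (sat (e i) (e-sat i))
  index : Fin (count f) → Fin (count g)
  index i = proj₁ (found i)
  index-inj : Injective _≡_ _≡_ index
  index-inj {i} {j} p = e-inj i j (inj (e i) (e j) (e-sat i) (e-sat j)
    (trans (sym (proj₂ (found i))) (trans (cong e′ p) (proj₂ (found j)))))

count≡1⁻ : ∀ {n} (f : Fin n → Bool) → count f ≡ 1 →
  ∃ λ x → f x ≡ true × (∀ y → f y ≡ true → y ≡ x)
count≡1⁻ f p with count f | p | enum f
... | .1 | refl | e , sat , inj , sur = e zero , sat zero , unique
  where
  unique : ∀ y → f y ≡ true → y ≡ e zero
  unique y q with sur y q
  ... | zero , r = sym r

count≡1⁺ : ∀ {n} (f : Fin n → Bool) x → f x ≡ true → (∀ y → f y ≡ true → y ≡ x) → count f ≡ 1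
count≡1⁺ f x p unique = ≤-antisym
  (count-inj-≤ f one (λ _ → zero) (λ _ _ → refl)
    (λ y z q r _ → trans (unique y q) (sym (unique z r))))
  (count-inj-≤ one f (λ _ → x) (λ _ _ → p) (λ { zero zero _ _ _ → refl }))
  where
  one : Fin 1 → Bool
  one _ = true

2≤count : ∀ {n} (f : Fin n → Bool) x y → f x ≡ true → f y ≡ true → x ≢ y → 2 ≤ count f
2≤count f x y p q x≢y = count-inj-≤ {2} (λ _ → true) f φ
  (λ { zero _ → p ; (suc zero) _ → q })
  (λ { zero zero _ _ _ → refl ; (suc zero) (suc zero) _ _ _ → refl
     ; zero (suc zero) _ _ r → ⊥-elim (x≢y r) ; (suc zero) zero _ _ r → ⊥-elim (x≢y (sym r)) })
  where
  φ : Fin 2 → _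
  φ zero    = x
  φ (suc _) = y

count-cong : ∀ {n} {f g : Fin n → Bool} → (∀ x → f x ≡ g x) → count f ≡ count g
count-cong {zero}  p = refl
count-cong {suc n} p = cong₂ _+_ (cong (if_then 1 else 0) (p zero)) (count-cong (p ∘ suc))

ind : Bool → ℕ
ind b = if b then 1 else 0

count-as-sum : ∀ {n} (f : Fin n → Bool) → count f ≡ sum (ind ∘ f)
count-as-sum {zero}  f = refl
count-as-sum {suc n} f = cong (ind (f zero) +_) (count-as-sum (f ∘ suc))

count-true : ∀ n → count {n} (λ _ → true) ≡ n
count-true zero    = refl
count-true (suc n) = cong suc (count-true n)

sum-mono-≤ : ∀ {n} {f g : Fin n → ℕ} → (∀ i → f i ≤ g i) → sum f ≤ sum g
sum-mono-≤ {zero}  p = z≤n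
sum-mono-≤ {suc n} p = +-mono-≤ (p zero) (sum-mono-≤ (p ∘ suc))

-- A strict failure at `i`, added to the inequalities elsewhere, would give `sum g < sum f`. This
-- isolates a single part of a join.
sum-tight : ∀ {n} {f g : Fin n → ℕ} i → (∀ j → j ≢ i → g j ≤ f j) → sum f ≤ sum g → f i ≤ g i
sum-tight {suc n} {f} {g} zero p q = ℕ.≮⇒≥ λ lt →
  ℕ.<⇒≱ (ℕ.+-mono-<-≤ lt (sum-mono-≤ (λ j → p (suc j) λ ()))) q
sum-tight {suc n} {f} {g} (suc i) p q = sum-tight i (λ j j≢i → p (suc j) (j≢i ∘ suc-injective))
  (ℕ.≮⇒≥ λ lt → ℕ.<⇒≱ (ℕ.+-mono-≤-< (p zero λ ()) lt) q)

-- Trees: leaves, paths and a proper 2-colouring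

module _ (G : Graph) where

  V : Set
  V = Fin (size G)

  Adj : V → V → Set
  Adj u v = adj G u v ≡ true

  Leaf Support SLink : V → Set
  Leaf v = isLeaf G v ≡ true
  Support v = isSupport G v ≡ true
  SLink v = isSupportLink G v ≡ true

  -- Degree 1 without the convention for `P₂`. It differs from `Leaf` only at two adjacent pendant
  -- vertices, where the one of smaller index is not a leaf.
  Pendant : V → Set
  Pendant v = ∃ λ u → Adj v u × (∀ z → Adj v z → z ≡ u)

  deg1⁻ : ∀ v → (deg G v ≡ᵇ 1) ≡ true → Pendant v
  deg1⁻ v p = count≡1⁻ (adj G v) (≡ᵇ⇒≡ _ 1 (≡⇒T p))

  deg1⁺ : ∀ v → Pendant v → (deg G v ≡ᵇ 1) ≡ true
  deg1⁺ v (u , p , q) = T⇒≡ (≡⇒≡ᵇ _ 1 (count≡1⁺ (adj G v) u p q))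

  leaf⁻ : ∀ v → Leaf v → Pendant v × (∀ u → Adj v u → Pendant u → toℕ u < toℕ v)
  leaf⁻ v l with ∧⁻ {deg G v ≡ᵇ 1} l
  ... | p , q = deg1⁻ v p , λ u a pu →
    <ᵇ⇒< _ _ (≡⇒T (imp⁻ {adj G v u ∧ (deg G u ≡ᵇ 1)} (allB⁻ _ q u) (∧⁺ a (deg1⁺ u pu))))

  leaf⁺ : ∀ v → Pendant v → (∀ u → Adj v u → Pendant u → toℕ u < toℕ v) → Leaf v
  leaf⁺ v p q = ∧⁺ (deg1⁺ v p) (allB⁺ _ λ u → imp⁺ {adj G v u ∧ (deg G u ≡ᵇ 1)} λ r →
    let a , d = ∧⁻ {adj G v u} r in T⇒≡ (<⇒<ᵇ (q u a (deg1⁻ u d))))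

  leaf-pendant : ∀ {v} → Leaf v → Pendant v
  leaf-pendant {v} l = proj₁ (leaf⁻ v l)

  pendant-unique : ∀ {v x y} → Pendant v → Adj v x → Adj v y → x ≡ y
  pendant-unique (_ , _ , q) a b = trans (q _ a) (sym (q _ b))

  support⁻ : ∀ v → Support v → ∃ λ u → Adj v u × Leaf u
  support⁻ v p with anyB⁻ _ p
  ... | u , q = u , ∧⁻ q

  support⁺ : ∀ {v u} → Adj v u → Leaf u → Support v
  support⁺ {v} {u} a l = anyB⁺ (λ z → adj G v z ∧ isLeaf G z) u (∧⁺ a l)

  slink⁻ : ∀ v → SLink v → ¬ Leaf v × ¬ Support v × (∀ u → Adj v u → Support u)
  slink⁻ v p with ∧⁻ {not (isLeaf G v)} p
  ... | a , q with ∧⁻ {not (isSupport G v)} q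
  ...   | b , c = (λ l → clash l (not⁻ a)) , (λ s → clash s (not⁻ b)) ,
                  λ u → imp⁻ {adj G v u} (allB⁻ _ c u)

  slink⁺ : ∀ v → ¬ Leaf v → ¬ Support v → (∀ u → Adj v u → Support u) → SLink v
  slink⁺ v a b c = ∧⁺ (not⁺ (¬-not a)) (∧⁺ (not⁺ (¬-not b)) (allB⁺ _ λ u → imp⁺ {adj G v u} (c u)))

  -- A path ending in `t` whose vertices all satisfy `Q`. Each new head must avoid every `vert` of
  -- the rest, hence the mutual definition.
  data SimplePath (Q : V → Set) (t : V) : V → Set
  len  : ∀ {Q t u} → SimplePath Q t u → ℕ
  vert : ∀ {Q t u} (p : SimplePath Q t u) → Fin (suc (len p)) → V

  data SimplePath Q t where
    end  : Q t → SimplePath Q t t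
    extend : ∀ {u z} → Q u → Adj u z → (p : SimplePath Q t z) → (∀ i → vert p i ≢ u) →
           SimplePath Q t u

  len (end _)        = 0
  len (extend _ _ p _) = suc (len p)

  vert {u = u} (end _)        _       = u
  vert {u = u} (extend _ _ p _) zero    = u
  vert         (extend _ _ p _) (suc i) = vert p i

  module _ {Q : V → Set} {t : V} where

    vert-zero : ∀ {u} (p : SimplePath Q t u) → vert p zero ≡ u
    vert-zero (end _)        = refl
    vert-zero (extend _ _ _ _) = refl

    vert-last : ∀ {u} (p : SimplePath Q t u) → vert p (fromℕ (len p)) ≡ t
    vert-last (end _)        = refl
    vert-last (extend _ _ p _) = vert-last p

    vert-inj : ∀ {u} (p : SimplePath Q t u) i j → vert p i ≡ vert p j → i ≡ j
    vert-inj (end _)        zero    zero    _ = refl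
    vert-inj (extend _ _ p f) zero    zero    _ = refl
    vert-inj (extend _ _ p f) zero    (suc j) e = ⊥-elim (f j (sym e))
    vert-inj (extend _ _ p f) (suc i) zero    e = ⊥-elim (f i e)
    vert-inj (extend _ _ p f) (suc i) (suc j) e = cong suc (vert-inj p i j e)

    vert-all : ∀ {u} (p : SimplePath Q t u) i → Q (vert p i)
    vert-all (end q)        _       = q
    vert-all (extend q _ p _) zero    = q
    vert-all (extend q _ p _) (suc i) = vert-all p i

    vert-adj : ∀ {u} (p : SimplePath Q t u) (i : Fin (len p)) →
               Adj (vert p (inject₁ i)) (vert p (suc i))
    vert-adj (extend {u} _ a p _) zero    = subst (Adj u) (sym (vert-zero p)) a
    vert-adj (extend _ _ p _)     (suc i) = vert-adj p i

    suffix : ∀ {u} (p : SimplePath Q t u) i → SimplePath Q t (vert p i)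
    suffix p@(end _)        zero    = p
    suffix p@(extend _ _ _ _) zero    = p
    suffix (extend _ _ p _)   (suc i) = suffix p i

  data WalkIn (Q : V → Set) : V → V → Set where
    done : ∀ {u} → Q u → WalkIn Q u u
    move : ∀ {u z v} → Q u → Adj u z → WalkIn Q z v → WalkIn Q u v

  _++ʷ_ : ∀ {Q u v x} → WalkIn Q u v → WalkIn Q v x → WalkIn Q u x
  done _     ++ʷ r = r
  move q a p ++ʷ r = move q a (p ++ʷ r)

  walkIn-head : ∀ {Q u v} → WalkIn Q u v → Q u
  walkIn-head (done q)     = q
  walkIn-head (move q _ _) = q

  simplify : ∀ {Q u v} → WalkIn Q u v → SimplePath Q v u
  simplify (done q) = end q
  simplify {u = u} (move q a w) with simplify w
  ... | p with any? (λ i → vert p i ≟ u)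
  -- The head already lies on the simplified rest; the suffix from there cuts out the loop.
  ...   | yes (i , e) = subst (SimplePath _ _) e (suffix p i)
  ...   | no ¬e       = extend q a p (λ i e → ¬e (i , e))

module Tree (G : Graph) (tree : IsTree G) where
  open IsTree tree

  adj-sym : ∀ {u v} → Adj G u v → Adj G v u
  adj-sym {u} {v} a = trans (symm v u) a

  adj-irrefl : ∀ {u} {A : Set} → Adj G u u → A
  adj-irrefl a = clash a (irrefl _)

  adj⇒≢ : ∀ {u v} → Adj G u v → u ≢ v
  adj⇒≢ a refl = adj-irrefl a

  reverse : ∀ {Q u v} → WalkIn G Q u v → WalkIn G Q v u
  reverse (done q)     = done q
  reverse (move q a w) = _++ʷ_ G (reverse w) (move (walkIn-head G w) (adj-sym a) (done q))

  -- A nontrivial simple path from `u` to `v` avoiding `w` would close up through `w` to a cycle.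
  -- Uniqueness arguments about trees below rest on this.
  no-detour : ∀ {w u v} → Adj G w u → Adj G w v → WalkIn G (_≢ w) u v → u ≡ v
  no-detour {w} {u} {v} a b walk with simplify G walk
  ... | end _ = refl
  -- An `extend` path has at least two vertices, so with `w` there are the three that `Cycle`
  -- demands.
  ... | p@(extend _ _ p′ _) = ⊥-elim (acyclic record
    { m     = len G p′
    ; c     = c
    ; inj   = λ {i} {j} → c-inj i j
    ; cons  = λ { zero → subst (Adj G w) (sym (vert-zero G p)) a ; (suc i) → vert-adj G p i }
    ; close = adj-sym (subst (Adj G w) (sym (vert-last G p)) b) })
    where
    c : Fin (suc (suc (suc (len G p′)))) → V G
    c zero    = w
    c (suc i) = vert G p i
    c-inj : ∀ i j → c i ≡ c j → i ≡ j
    c-inj zero    zero    _ = refl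
    c-inj zero    (suc j) e = ⊥-elim (vert-all G p j (sym e))
    c-inj (suc i) zero    e = ⊥-elim (vert-all G p i e)
    c-inj (suc i) (suc j) e = cong suc (vert-inj G p i j e)

  -- There is no 4-cycle: the walk `a`, `v`, `b` avoids `u`.
  common-unique : ∀ {u v a b} → u ≢ v → Adj G u a → Adj G v a → Adj G u b → Adj G v b → a ≡ b
  common-unique u≢v ua va ub vb = no-detour ua ub
    (move (λ e → adj⇒≢ ua (sym e)) (adj-sym va)
      (move (λ e → u≢v (sym e)) vb (done (λ e → adj⇒≢ ub (sym e)))))

  neighbour : ∀ {u v} → u ≢ v → ∃ λ z → Adj G u z
  neighbour {u} {v} u≢v with connected u v
  ... | here     = ⊥-elim (u≢v refl)
  ... | step a _ = _ , a

  -- No walk starting at `u` leaves the pair, so by connectedness the tree is `P₂`.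
  pendant-pair : ∀ {u v} → Adj G u v → Pendant G u → Pendant G v → ∀ x → x ≡ u ⊎ x ≡ v
  pendant-pair {u} {v} a pu pv x = go (connected u x) (inj₁ refl)
    where
    go : ∀ {y} → Walk G y x → y ≡ u ⊎ y ≡ v → x ≡ u ⊎ x ≡ v
    go here       e           = e
    go (step b w) (inj₁ refl) = go w (inj₂ (pendant-unique G pu b a))
    go (step b w) (inj₂ refl) = go w (inj₁ (pendant-unique G pv b (adj-sym a)))

  -- Two adjacent leaves would each have the smaller index by the tie-break for `P₂`.
  support-not-leaf : ∀ {v} → Support G v → ¬ Leaf G v
  support-not-leaf {v} s l with support⁻ G v s
  ... | y , a , ly = ℕ.<-asym (proj₂ (leaf⁻ G v l) y a (leaf-pendant G ly))
                              (proj₂ (leaf⁻ G y ly) v (adj-sym a) (leaf-pendant G l))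

-- Breadth-first depth: the length of a shortest walk to the root.
module Rooted (G : Graph) (tree : IsTree G) (root : V G) where
  open IsTree tree
  open Tree G tree

  -- Decides whether a walk of length exactly `k` leads to the root, so that the depth can be found
  -- by a least-number search.
  walkOf : ℕ → V G → Bool
  walkOf zero    x = x ==F root
  walkOf (suc k) x = anyB (λ y → adj G x y ∧ walkOf k y)

  walkLength : ∀ {x} → Walk G x root → ∃ λ k → walkOf k x ≡ true
  walkLength here = 0 , ==F-refl root
  walkLength {x} (step {w = y} a w) with walkLength w
  ... | k , p = suc k , anyB⁺ (λ y → adj G x y ∧ walkOf k y) y (∧⁺ a p)

  least : ∀ (P : ℕ → Bool) k → P k ≡ true → ∃ λ m → P m ≡ true × (∀ j → P j ≡ true → m ≤ j)
  least P k p with P 0 ≟ᵇ true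
  ... | yes q = 0 , q , λ _ _ → z≤n
  least P zero    p | no ¬q = ⊥-elim (¬q p)
  least P (suc k) p | no ¬q with least (P ∘ suc) k p
  ... | m , q , r = suc m , q , λ { zero s → ⊥-elim (¬q s) ; (suc j) s → s≤s (r j s) }

  depthOf : ∀ x → ∃ λ m → walkOf m x ≡ true × (∀ j → walkOf j x ≡ true → m ≤ j)
  depthOf x with walkLength (connected x root)
  ... | k , p = least (λ k → walkOf k x) k p

  depth : V G → ℕ
  depth x = proj₁ (depthOf x)

  depth-zero : ∀ x → depth x ≡ 0 → x ≡ root
  depth-zero x e = ==F⁻ (subst (λ m → walkOf m x ≡ true) e (proj₁ (proj₂ (depthOf x))))

  depth-root : depth root ≡ 0
  depth-root = ℕ.n≤0⇒n≡0 (proj₂ (proj₂ (depthOf root)) 0 (==F-refl root))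

  depth-adj : ∀ {x y} → Adj G x y → depth x ≤ suc (depth y)
  depth-adj {x} {y} a = proj₂ (proj₂ (depthOf x)) (suc (depth y))
    (anyB⁺ (λ z → adj G x z ∧ walkOf (depth y) z) y (∧⁺ a (proj₁ (proj₂ (depthOf y)))))

  upper : ∀ x {m} → depth x ≡ suc m → ∃ λ y → Adj G x y × depth y ≡ m
  upper x {m} e with anyB⁻ _ (subst (λ m → walkOf m x ≡ true) e (proj₁ (proj₂ (depthOf x))))
  ... | y , p with ∧⁻ {adj G x y} p
  ...   | a , q = y , a , ℕ.≤-antisym (proj₂ (proj₂ (depthOf y)) m q)
                            (ℕ.≤-pred (subst (_≤ suc (depth y)) e (depth-adj a)))

  -- After the first vertex, a climb from `z` to the root is strictly less deep than `x`, so it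
  -- never meets `x`.
  ascend : ∀ {x} m z → depth z ≡ m → z ≢ x → depth z ≤ depth x → WalkIn G (_≢ x) z root
  ascend zero z e z≢x _ with depth-zero z e
  ... | refl = done z≢x
  ascend (suc m) z e z≢x le with upper z e
  ... | y , a , q = move z≢x a (ascend m y q
    (λ { refl → ℕ.<⇒≱ (ℕ.≤-reflexive (trans (cong suc q) (sym e))) le })
    (ℕ.≤-trans (ℕ.≤-trans (ℕ.≤-reflexive q) (ℕ.n≤1+n m)) (ℕ.≤-trans (ℕ.≤-reflexive (sym e)) le)))

  -- Both neighbours climb to the root without meeting `x`; joined there, the climbs form a detour.
  upper-unique : ∀ {x u v} → Adj G x u → Adj G x v → depth u ≤ depth x → depth v ≤ depth x → u ≡ v
  upper-unique a b p q = no-detour a b (_++ʷ_ G (ascend _ _ refl (λ e → adj⇒≢ a (sym e)) p)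
    (reverse (ascend _ _ refl (λ e → adj⇒≢ b (sym e)) q)))

  -- A neighbour on the same level would coincide with the upper neighbour, which lies one level
  -- higher. On level zero there is only the root.
  depth-≢ : ∀ {x y} → Adj G x y → depth x ≢ depth y
  depth-≢ {x} {y} a e with depth x in dx
  ... | zero = adj⇒≢ a (trans (depth-zero x dx) (sym (depth-zero y (sym e))))
  ... | suc m with upper x dx
  ...   | p , b , q = ℕ.1+n≢n (trans e (trans (cong depth (sym p≡y)) q))
    where
    p≡y : p ≡ y
    p≡y = upper-unique b a (ℕ.≤-trans (ℕ.≤-reflexive q) (ℕ.≤-trans (ℕ.n≤1+n m) (ℕ.≤-reflexive (sym dx))))
      (ℕ.≤-reflexive (trans (sym e) (sym dx)))

  depth-step : ∀ {x y} → Adj G x y → depth x ≡ suc (depth y) ⊎ depth y ≡ suc (depth x)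
  depth-step {x} {y} a with ℕ.<-cmp (depth x) (depth y)
  ... | tri< lt _ _ = inj₂ (ℕ.≤-antisym (depth-adj (adj-sym a)) lt)
  ... | tri≈ _ e _ = ⊥-elim (depth-≢ a e)
  ... | tri> _ _ gt = inj₁ (ℕ.≤-antisym (depth-adj a) gt)

  parity : ℕ → Bool
  parity zero    = true
  parity (suc n) = not (parity n)

  colour : V G → Bool
  colour x = parity (depth x)

  not-fixed : ∀ b → b ≢ not b
  not-fixed true ()
  not-fixed false ()

  colour-proper : ∀ {x y} → Adj G x y → colour x ≢ colour y
  colour-proper {x} {y} a e with depth-step a
  ... | inj₁ d = not-fixed (colour y) (trans (sym e) (cong parity d))
  ... | inj₂ d = not-fixed (colour x) (trans e (cong parity d))

-- Upper bound on the locating-dominating number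

infix 4 _sumsTo_

-- Wrapping the equation keeps the summand as a parameter, so that `sum-+` and `sum-double` can be
-- chained without naming the functions.
record _sumsTo_ {n} (f : Fin n → ℕ) (a : ℕ) : Set where
  constructor total
  field sum≡ : sum f ≡ a
open _sumsTo_

sum-+ : ∀ {n} {f g : Fin n → ℕ} {a b} → f sumsTo a → g sumsTo b → (λ i → f i + g i) sumsTo a + b
sum-+ {f = f} {g} (total p) (total q) = total (trans (∑-distrib-+ f g) (cong₂ _+_ p q))

sum-double : ∀ {n} {f : Fin n → ℕ} {a} → f sumsTo a → (λ i → 2 * f i) sumsTo 2 * a
sum-double {f = f} (total p) = total (trans (sym (*-distribˡ-sum 2 f)) (cong (2 *_) p))

sum-ind : ∀ {n} (f : Fin n → Bool) → (λ i → ind (f i)) sumsTo count f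
sum-ind f = total (sym (count-as-sum f))

sum-one : ∀ n → (λ (_ : Fin n) → 1) sumsTo n
sum-one n = total (trans (sum≡ (sum-ind {n} (λ _ → true))) (count-true n))

sumsTo-≤ : ∀ {n} {f g : Fin n → ℕ} {a b} → f sumsTo a → g sumsTo b → (∀ i → f i ≤ g i) → a ≤ b
sumsTo-≤ (total refl) (total refl) p = sum-mono-≤ p

-- A witness of the general upper bound. It contains all support vertices so that it can be glued
-- along any of them.
Sparse : (G : Graph) → (Fin (size G) → Bool) → Set
Sparse G D = IsLD G D × (∀ v → Support G v → D v ≡ true) × 2 * count D + s G + sl G ≤ size G + ℓ G

-- The averaging step: `x` and `y` are the sizes of the sets for the two colours, `c` counts the
-- chosen leaves and `k` the support links.
halve : ∀ {x y c k} n l {s} → x ≤ y → s ≤ c → x + y + 2 * c + k ≤ n + l + s → 2 * x + s + k ≤ n + l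
halve {x} {y} {c} {k} n l {s} xy sc p = ℕ.+-cancelʳ-≤ s _ _ (begin
  2 * x + s + k + s   ≡⟨ shuffle x s k ⟩
  x + x + 2 * s + k   ≤⟨ ℕ.+-monoˡ-≤ k (ℕ.+-mono-≤ (ℕ.+-monoʳ-≤ x xy) (ℕ.*-monoʳ-≤ 2 sc)) ⟩
  x + y + 2 * c + k   ≤⟨ p ⟩
  n + l + s           ∎)
  where
  open ℕ.≤-Reasoning
  shuffle : ∀ x s k → 2 * x + s + k + s ≡ x + x + 2 * s + k
  shuffle = solve-∀

module UpperBound (G : Graph) (tree : IsTree G) (nbr : ∀ v → ∃ λ z → Adj G v z) where
  open Tree G tree
  open Rooted G tree (fromℕ< (IsTree.nonempty tree)) using (colour; colour-proper)

  leafAt : ∀ v → Dec (∃ λ y → adj G v y ∧ isLeaf G y ≡ true)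
  leafAt v = any? (λ y → (adj G v y ∧ isLeaf G y) ≟ᵇ true)

  pick : V G → V G
  pick v with leafAt v
  ... | yes (y , _) = y
  ... | no _        = v

  pick-spec : ∀ v → Support G v → Adj G v (pick v) × Leaf G (pick v)
  pick-spec v sv with leafAt v
  ... | yes (y , p) = ∧⁻ p
  ... | no ¬p       = ⊥-elim (¬p (anyB⁻ _ sv))

  -- A leaf has a single neighbour, so for leaves `picked` says that this support vertex selects it.
  picked chosen : V G → Bool
  picked x = allB (λ v → not (adj G x v) ∨ (x ==F pick v))
  chosen x = isLeaf G x ∧ picked x

  chosen-pick : ∀ {x v} → chosen x ≡ true → Adj G x v → x ≡ pick v
  chosen-pick {x} {v} c a = ==F⁻ (imp⁻ {adj G x v} (allB⁻ _ (proj₂ (∧⁻ {isLeaf G x} c)) v) a)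

  s≤chosen : s G ≤ count chosen
  s≤chosen = count-inj-≤ (isSupport G) chosen pick sat inj
    where
    sat : ∀ v → Support G v → chosen (pick v) ≡ true
    sat v sv with pick-spec v sv
    ... | a , l = ∧⁺ l (allB⁺ _ λ u → imp⁺ {adj G (pick v) u} λ b →
      subst (λ z → pick v ==F pick z ≡ true)
        (pendant-unique G (leaf-pendant G l) (adj-sym a) b) (==F-refl (pick v)))
    inj : ∀ u v → Support G u → Support G v → pick u ≡ pick v → u ≡ v
    inj u v su sv e with pick-spec u su | pick-spec v sv
    ... | a , l | b , _ = pendant-unique G (leaf-pendant G l) (adj-sym a)
                            (adj-sym (subst (Adj G v) (sym e) b))

  side : Bool → V G → Bool
  side true  x = colour x
  side false x = not (colour x)

  side-proper : ∀ b {x y} → Adj G x y → side b x ≡ true → side b y ≡ true → ⊥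
  side-proper true  a p q = colour-proper a (trans p (sym q))
  side-proper false a p q = colour-proper a (trans (not⁻ p) (sym (not⁻ q)))

  omit : Bool → V G → Bool
  omit b x = chosen x ∨ isSupportLink G x ∨ not (isLeaf G x) ∧ not (isSupport G x) ∧ side b x

  D : Bool → V G → Bool
  D b x = not (omit b x)

  Inner : Bool → V G → Set
  Inner b x = ¬ Leaf G x × ¬ Support G x × (SLink G x ⊎ side b x ≡ true)

  omit⁻ : ∀ b x → omit b x ≡ true → chosen x ≡ true ⊎ Inner b x
  omit⁻ b x p with ∨⁻ {chosen x} p
  ... | inj₁ c = inj₁ c
  ... | inj₂ q with ∨⁻ {isSupportLink G x} q
  ...   | inj₁ k = inj₂ (proj₁ (slink⁻ G x k) , proj₁ (proj₂ (slink⁻ G x k)) , inj₁ k)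
  ...   | inj₂ r with ∧⁻ {not (isLeaf G x)} r
  ...     | nl , r′ with ∧⁻ {not (isSupport G x)} r′
  ...       | ns , c = inj₂ ((λ l → clash l (not⁻ nl)) , (λ t → clash t (not⁻ ns)) , inj₂ c)

  chosen-leaf : ∀ {x} → chosen x ≡ true → Leaf G x
  chosen-leaf {x} c = proj₁ (∧⁻ {isLeaf G x} c)

  support-kept : ∀ b {x} → Support G x → omit b x ≡ true → ⊥
  support-kept b {x} sx p with omit⁻ b x p
  ... | inj₁ c            = support-not-leaf sx (chosen-leaf c)
  ... | inj₂ (_ , ns , _) = ns sx

  -- Chosen leaves and support links have only support vertices as neighbours, and these are kept.
  -- All other omitted vertices share a colour.
  omit-indep : ∀ b {x y} → Adj G x y → omit b x ≡ true → omit b y ≡ true → ⊥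
  omit-indep b {x} {y} a p q with omit⁻ b x p | omit⁻ b y q
  ... | inj₁ c | _ = support-kept b (support⁺ G (adj-sym a) (chosen-leaf c)) q
  ... | inj₂ _ | inj₁ c = support-kept b (support⁺ G a (chosen-leaf c)) p
  ... | inj₂ (_ , _ , inj₁ k) | inj₂ (_ , ns , _) = ns (proj₂ (proj₂ (slink⁻ G x k)) y a)
  ... | inj₂ (_ , ns , _) | inj₂ (_ , _ , inj₁ k) = ns (proj₂ (proj₂ (slink⁻ G y k)) x (adj-sym a))
  ... | inj₂ (_ , _ , inj₂ c) | inj₂ (_ , _ , inj₂ d) = side-proper b a c d

  not-false : ∀ {c} → not c ≡ false → c ≡ true
  not-false {true} _ = refl

  nbr-in-D : ∀ b {x y} → Adj G x y → omit b x ≡ true → D b y ≡ true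
  nbr-in-D b a p = not⁺ (¬-not (omit-indep b a p))

  -- The second neighbour `v` shows that `a` is not pendant, so the tie-break is void and `u` is a
  -- leaf. An omitted leaf is the one that its neighbour picks.
  shared-pendant : ∀ b {u v a} → u ≢ v → Pendant G u → Adj G u a → Adj G v a →
                   omit b u ≡ true → u ≡ pick a
  shared-pendant b {u} {v} {a} u≢v pu ua va p with omit⁻ b u p
  ... | inj₁ c            = chosen-pick c ua
  ... | inj₂ (nl , _ , _) = ⊥-elim (nl (leaf⁺ G u pu λ z uz pz →
    ⊥-elim (u≢v (pendant-unique G
      (subst (Pendant G) (pendant-unique G pu uz ua) pz) (adj-sym ua) (adj-sym va)))))

  -- Without 4-cycles a common neighbourhood is a single vertex, and both `u` and `v` would be the
  -- leaf picked there.
  distinct-nbrs : ∀ b {u v} → u ≢ v → omit b u ≡ true → omit b v ≡ true →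
                  (∀ z → Adj G u z → Adj G v z) → (∀ z → Adj G v z → Adj G u z) → ⊥
  distinct-nbrs b {u} {v} u≢v p q uv vu with nbr u
  ... | a , ua = u≢v (trans (shared-pendant b u≢v (a , ua , only) ua va p)
                      (sym (shared-pendant b (u≢v ∘ sym) (a , va , λ z vz → only z (vu z vz)) va ua q)))
    where
    va : Adj G v a
    va = uv a ua
    only : ∀ z → Adj G u z → z ≡ a
    only z uz = common-unique u≢v uz (uv z uz) ua va

  -- By independence all neighbours of an omitted vertex are kept, so domination needs just one
  -- neighbour and location just distinct neighbourhoods.
  isLD : ∀ b → IsLD G (D b)
  isLD b = record { dominating = dom ; locating = loc }
    where
    dom : ∀ u → D b u ≡ false → ∃ λ w → D b w ≡ true × Adj G u w
    dom u p with nbr u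
    ... | z , a = z , nbr-in-D b a (not-false p) , a
    loc : ∀ u v → D b u ≡ false → D b v ≡ false → u ≢ v →
          ∃ λ w → D b w ≡ true × adj G u w ≢ adj G v w
    loc u v p q u≢v with any? (λ w → ¬? (adj G u w ≟ᵇ adj G v w))
    ... | yes (w , ne) with adj G u w in eu | adj G v w in ev
    ...   | true | _ = w , nbr-in-D b eu (not-false p) , λ e → ne (trans (sym eu) (trans e ev))
    ...   | false | true = w , nbr-in-D b ev (not-false q) , λ e → ne (trans (sym eu) (trans e ev))
    ...   | false | false = ⊥-elim (ne refl)
    loc u v p q u≢v | no same = ⊥-elim (distinct-nbrs b u≢v (not-false p) (not-false q)
      (λ z a → trans (sym (agree z)) a) (λ z a → trans (agree z) a))
      where
      agree : ∀ w → adj G u w ≡ adj G v w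
      agree w = decidable-stable (adj G u w ≟ᵇ adj G v w) λ ne → same (w , ne)

  -- The count at one vertex, checked on a truth table with the five predicates as free booleans.
  -- Both sides are 2 at leaves and support vertices and 1 at all others; the rows that are leaf and
  -- support at once have slack.
  tally : ∀ x → ind (D true x) + ind (D false x) + 2 * ind (chosen x) + ind (isSupportLink G x)
              ≤ 1 + ind (isLeaf G x) + ind (isSupport G x)
  tally x = ℕ.≤ᵇ⇒≤ _ _ (≡⇒T (table (isLeaf G x) (isSupport G x)
      (allB (λ u → not (adj G x u) ∨ isSupport G u)) (picked x) (colour x)))
    where
    entry : (a b c q d : Bool) → Bool
    entry a b c q d = let k = not a ∧ not b ∧ c in
      ind (not ((a ∧ q) ∨ k ∨ not a ∧ not b ∧ d)) + ind (not ((a ∧ q) ∨ k ∨ not a ∧ not b ∧ not d))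
        + 2 * ind (a ∧ q) + ind k
      ≤ᵇ 1 + ind a + ind b
    table : ∀ a b c q d → entry a b c q d ≡ true
    table true  true  _     true  _     = refl
    table true  true  _     false _     = refl
    table true  false _     true  _     = refl
    table true  false _     false _     = refl
    table false true  _     _     _     = refl
    table false false true  _     _     = refl
    table false false false _     true  = refl
    table false false false _     false = refl

  tally-sum : count (D true) + count (D false) + 2 * count chosen + sl G ≤ size G + ℓ G + s G
  tally-sum = sumsTo-≤
    (sum-+ (sum-+ (sum-+ (sum-ind (D true)) (sum-ind (D false))) (sum-double (sum-ind chosen)))
           (sum-ind (isSupportLink G)))
    (sum-+ (sum-+ (sum-one (size G)) (sum-ind (isLeaf G))) (sum-ind (isSupport G)))
    tally

  sparse : ∃ (Sparse G)
  sparse with ℕ.≤-total (count (D true)) (count (D false))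
  ... | inj₁ le = D true , isLD true , (λ v t → not⁺ (¬-not (support-kept true t)))
                , halve {y = count (D false)} (size G) (ℓ G) le s≤chosen tally-sum
  ... | inj₂ le = D false , isLD false , (λ v t → not⁺ (¬-not (support-kept false t)))
                , halve {y = count (D true)} (size G) (ℓ G) le s≤chosen
                    (subst (λ m → m + 2 * count chosen + sl G ≤ size G + ℓ G + s G)
                      (ℕ.+-comm (count (D true)) (count (D false))) tally-sum)

-- Locating-dominating sets with prescribed support vertices

-- An unselected support vertex v forces its leaf y to be selected, and v can take over from y.
module Swap (G : Graph) (tree : IsTree G) (S : V G → Bool) (ld : IsLD G S)
  (v : V G) (v∉S : S v ≡ false) (y : V G) (vy : Adj G v y) (leaf-y : Leaf G y) where
  open Tree G tree
  open IsLD ld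

  only-v : ∀ {z} → Adj G z y → z ≡ v
  only-v a = pendant-unique G (leaf-pendant G leaf-y) (adj-sym a) (adj-sym vy)

  y∈S : S y ≡ true
  y∈S with S y in e
  ... | true  = refl
  ... | false with dominating y e
  ...   | z , z∈S , a = clash (subst (λ z → S z ≡ true) (only-v (adj-sym a)) z∈S) v∉S

  S′ : V G → Bool
  S′ x = (x ==F v) ∨ S x ∧ not (x ==F y)

  v∈S′ : S′ v ≡ true
  v∈S′ = ∨⁺ˡ (==F-refl v)

  ∈S′ : ∀ {x} → S x ≡ true → x ≢ y → S′ x ≡ true
  ∈S′ {x} p x≢y = ∨⁺ʳ {x ==F v} (∧⁺ p (not⁺ (==F-≢ x≢y)))

  ∉S′ : ∀ {x} → S′ x ≡ false → x ≢ v × (x ≡ y ⊎ S x ≡ false)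
  ∉S′ {x} p = (λ { refl → clash v∈S′ p }) , other
    where
    other : x ≡ y ⊎ S x ≡ false
    other with x ≟ y | S x ≟ᵇ true
    ... | yes q | _     = inj₁ q
    ... | no q  | yes e = clash (∈S′ e q) p
    ... | no _  | no ¬e = inj₂ (¬-not ¬e)

  ∈S′⁻ : ∀ {x} → S′ x ≡ true → x ≡ v ⊎ (S x ≡ true × x ≢ y)
  ∈S′⁻ {x} p with ∨⁻ {x ==F v} p
  ... | inj₁ e = inj₁ (==F⁻ e)
  ... | inj₂ q with ∧⁻ {S x} q
  ...   | t , n = inj₂ (t , λ { refl → clash (==F-refl x) (not⁻ n) })

  isLD : IsLD G S′
  isLD = record { dominating = dom ; locating = loc }
    where
    -- The old dominator of `u` survives: it is not `y`, whose only neighbour is `v`.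
    nbr∈S′ : ∀ {u} → u ≢ v → S u ≡ false → ∃ λ w → S′ w ≡ true × Adj G u w × w ≢ v
    nbr∈S′ u≢v p with dominating _ p
    ... | w , w∈S , a = w , ∈S′ w∈S (λ { refl → u≢v (only-v a) }) , a , λ { refl → clash w∈S v∉S }
    dom : ∀ u → S′ u ≡ false → ∃ λ w → S′ w ≡ true × Adj G u w
    dom u p with ∉S′ p
    ... | _   , inj₁ refl = v , v∈S′ , adj-sym vy
    ... | u≢v , inj₂ q with nbr∈S′ u≢v q
    ...   | w , r , a , _ = w , r , a
    loc : ∀ u x → S′ u ≡ false → S′ x ≡ false → u ≢ x →
          ∃ λ w → S′ w ≡ true × adj G u w ≢ adj G x w
    loc u x p q u≢x with ∉S′ p | ∉S′ q
    ... | _ , inj₁ refl | _ , inj₁ refl = ⊥-elim (u≢x refl)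
    -- The dominator of `x` separates `x` from `y`, since it differs from the only neighbour `v` of
    -- `y`.
    ... | _ , inj₁ refl | x≢v , inj₂ n with nbr∈S′ x≢v n
    ...   | w , r , a , w≢v = w , r , λ e → w≢v (only-v (adj-sym (trans e a)))
    loc u x p q u≢x | u≢v , inj₂ n | _ , inj₁ refl with nbr∈S′ u≢v n
    ...   | w , r , a , w≢v = w , r , λ e → w≢v (only-v (adj-sym (trans (sym e) a)))
    loc u x p q u≢x | u≢v , inj₂ m | x≢v , inj₂ n with locating u x m n u≢x
    ...   | w , w∈S , ne = w , ∈S′ w∈S w≢y , ne
      where
      -- The removed leaf separates nothing here, as neither vertex is its neighbour `v`.
      w≢y : w ≢ y
      w≢y refl = ne (trans (¬-not (u≢v ∘ only-v)) (sym (¬-not (x≢v ∘ only-v))))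

  count-≤ : count S′ ≤ count S
  count-≤ = count-inj-≤ S′ S φ sat inj
    where
    φ : V G → V G
    φ x with x ≟ v
    ... | yes _ = y
    ... | no _  = x
    sat : ∀ x → S′ x ≡ true → S (φ x) ≡ true
    sat x p with x ≟ v | ∈S′⁻ p
    ... | yes _ | _            = y∈S
    ... | no ¬e | inj₁ e       = ⊥-elim (¬e e)
    ... | no ¬e | inj₂ (t , _) = t
    inj : ∀ a b → S′ a ≡ true → S′ b ≡ true → φ a ≡ φ b → a ≡ b
    inj a b p q e with a ≟ v | b ≟ v | ∈S′⁻ p | ∈S′⁻ q
    ... | yes r | yes t | _ | _ = trans r (sym t)
    ... | yes r | no t  | _ | inj₁ f = ⊥-elim (t f)
    ... | yes r | no t  | _ | inj₂ (_ , f) = ⊥-elim (f (sym e))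
    ... | no r  | yes t | inj₁ f | _ = ⊥-elim (r f)
    ... | no r  | yes t | inj₂ (_ , f) | _ = ⊥-elim (f e)
    ... | no r  | no t  | _ | _ = e

module _ (G : Graph) (tree : IsTree G) where

  -- One swap at a time. Each removes only a leaf, so support vertices already secured stay in the
  -- set.
  select-supports : ∀ {m} (g : Fin m → V G) → (∀ i → Support G (g i)) → ∀ S → IsLD G S →
    ∃ λ S′ → IsLD G S′ × count S′ ≤ count S × (∀ i → S′ (g i) ≡ true)
  select-supports {zero} g sup S ld = S , ld , ℕ.≤-refl , λ ()
  select-supports {suc m} g sup S ld with select-supports (g ∘ suc) (sup ∘ suc) S ld
  ... | S₁ , ld₁ , le , mem with S₁ (g zero) in e
  ...   | true  = S₁ , ld₁ , le , λ { zero → e ; (suc i) → mem i }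
  ...   | false with support⁻ G (g zero) (sup zero)
  ...     | y , a , l = S′ , isLD , ℕ.≤-trans count-≤ le
                      , λ { zero → v∈S′
                          ; (suc i) → ∈S′ (mem i) (λ { refl → Tree.support-not-leaf G tree (sup (suc i)) l }) }
    where open Swap G tree S₁ ld₁ (g zero) e y a l

-- The operation SL

Part : ∀ {k} → (Fin k → Graph) → Set
Part {k} Ts = Σ (Fin k) λ i → Fin (size (Ts i))

-- T arises from the graphs Ts by joining the vertices vs to a new vertex, up to isomorphism.
record Join (T : Graph) {k : ℕ} (Ts : Fin k → Graph) (vs : ∀ i → Fin (size (Ts i))) : Set where
  field
    w      : V T
    e      : ∀ i → Fin (size (Ts i)) → V T
    cover  : ∀ z → z ≡ w ⊎ ∃₂ λ i x → z ≡ e i x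
    e-inj  : ∀ {i j x y} → e i x ≡ e j y → _≡_ {A = Part Ts} (i , x) (j , y)
    e≢w    : ∀ {i x} → e i x ≢ w
    adj-ww : adj T w w ≡ false
    adj-we : ∀ i x → adj T w (e i x) ≡ (x ==F vs i)
    adj-ew : ∀ i x → adj T (e i x) w ≡ (x ==F vs i)
    adj-ee : ∀ i x y → adj T (e i x) (e i y) ≡ adj (Ts i) x y
    adj-≢  : ∀ {i j} x y → i ≢ j → adj T (e i x) (e j y) ≡ false

module _ {T U : Graph} {k : ℕ} {Ts : Fin k → Graph} {vs : ∀ i → Fin (size (Ts i))} where

  join-map : Join T Ts vs → Join U Ts vs → V T → V U
  join-map J K z with Join.cover J z
  ... | inj₁ _           = Join.w K
  ... | inj₂ (i , x , _) = Join.e K i x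

  join-map-w : ∀ J K → join-map J K (Join.w J) ≡ Join.w K
  join-map-w J K with Join.cover J (Join.w J)
  ... | inj₁ _           = refl
  ... | inj₂ (i , x , p) = ⊥-elim (Join.e≢w J (sym p))

  join-map-e : ∀ J K i x → join-map J K (Join.e J i x) ≡ Join.e K i x
  join-map-e J K i x with Join.cover J (Join.e J i x)
  ... | inj₁ p = ⊥-elim (Join.e≢w J p)
  ... | inj₂ (j , y , p) with Join.e-inj J p
  ...   | refl = refl

module _ {T U : Graph} {k : ℕ} {Ts : Fin k → Graph} {vs : ∀ i → Fin (size (Ts i))} where

  -- Kept in a module of its own because `join-map` occurs here with the two graphs in both orders.
  join-map-inverse : (J : Join T Ts vs) (K : Join U Ts vs) → ∀ z → join-map K J (join-map J K z) ≡ z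
  join-map-inverse J K z with Join.cover J z
  ... | inj₁ refl           = join-map-w K J
  ... | inj₂ (i , x , refl) = join-map-e K J i x

module _ {T U : Graph} {k : ℕ} {Ts : Fin k → Graph} {vs : ∀ i → Fin (size (Ts i))} where

  join-map-adj : (J : Join T Ts vs) (K : Join U Ts vs) → ∀ y z →
                 adj U (join-map J K y) (join-map J K z) ≡ adj T y z
  join-map-adj J K y z with Join.cover J y | Join.cover J z
  ... | inj₁ refl | inj₁ refl = trans (Join.adj-ww K) (sym (Join.adj-ww J))
  ... | inj₁ refl | inj₂ (i , x , refl) = trans (Join.adj-we K i x) (sym (Join.adj-we J i x))
  ... | inj₂ (i , x , refl) | inj₁ refl = trans (Join.adj-ew K i x) (sym (Join.adj-ew J i x))
  ... | inj₂ (i , x , refl) | inj₂ (j , x′ , refl) with i ≟ j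
  ...   | yes refl = trans (Join.adj-ee K i x x′) (sym (Join.adj-ee J i x x′))
  ...   | no i≢j   = trans (Join.adj-≢ K x x′ i≢j) (sym (Join.adj-≢ J x x′ i≢j))

  -- The fields of `Join` determine every adjacency, so matching centre with centre and part with
  -- part is an isomorphism.
  join-iso : Join T Ts vs → Join U Ts vs → Iso T U
  join-iso J K = record
    { to = join-map J K ; from = join-map K J
    ; from∘to = join-map-inverse J K ; to∘from = join-map-inverse K J
    ; pres = join-map-adj J K }

  join-transport : Join T Ts vs → Iso T U → Join U Ts vs
  join-transport J I = record
    { w = to w
    ; e = λ i x → to (e i x)
    ; cover = cover′
    ; e-inj = λ p → e-inj (to-inj p)
    ; e≢w = λ p → e≢w (to-inj p)
    ; adj-ww = trans (pres _ _) adj-ww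
    ; adj-we = λ i x → trans (pres _ _) (adj-we i x)
    ; adj-ew = λ i x → trans (pres _ _) (adj-ew i x)
    ; adj-ee = λ i x y → trans (pres _ _) (adj-ee i x y)
    ; adj-≢ = λ x y i≢j → trans (pres _ _) (adj-≢ x y i≢j) }
    where
    open Iso I
    open Join J
    to-inj : ∀ {x y} → to x ≡ to y → x ≡ y
    to-inj {x} {y} p = trans (sym (from∘to x)) (trans (cong from p) (from∘to y))
    cover′ : ∀ z → z ≡ to w ⊎ ∃₂ λ i x → z ≡ to (e i x)
    cover′ z with cover (from z)
    ... | inj₁ p           = inj₁ (trans (sym (to∘from z)) (cong to p))
    ... | inj₂ (i , x , p) = inj₂ (i , x , trans (sym (to∘from z)) (cong to p))

isZero-↑ˡ : ∀ {m} (x : Fin m) n → isZero (x ↑ˡ n) ≡ isZero x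
isZero-↑ˡ zero    n = refl
isZero-↑ˡ (suc x) n = refl

isZero-↑ʳ : ∀ {m n} (y : Fin n) → Fin m → isZero (m ↑ʳ y) ≡ false
isZero-↑ʳ {suc m} y _ = refl

↑ˡ≢↑ʳ : ∀ {m n} (x : Fin m) (y : Fin n) → x ↑ˡ n ≢ m ↑ʳ y
↑ˡ≢↑ʳ {m} {n} x y p with trans (sym (splitAt-↑ˡ m x n)) (trans (cong (splitAt m) p) (splitAt-↑ʳ m n y))
... | ()

module _ (H G : Graph) (v : Fin (size G)) where

  private
    l : Fin (size H) → V (attach H G v)
    l x = x ↑ˡ size G
    r : Fin (size G) → V (attach H G v)
    r y = size H ↑ʳ y

  attach-ll : ∀ x y → adj (attach H G v) (l x) (l y) ≡ adj H x y
  attach-ll x y rewrite splitAt-↑ˡ (size H) x (size G) | splitAt-↑ˡ (size H) y (size G) = refl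

  attach-rr : ∀ x y → adj (attach H G v) (r x) (r y) ≡ adj G x y
  attach-rr x y rewrite splitAt-↑ʳ (size H) (size G) x | splitAt-↑ʳ (size H) (size G) y = refl

  attach-lr : ∀ x y → adj (attach H G v) (l x) (r y) ≡ isZero x ∧ (y ==F v)
  attach-lr x y rewrite splitAt-↑ˡ (size H) x (size G) | splitAt-↑ʳ (size H) (size G) y = refl

  attach-rl : ∀ x y → adj (attach H G v) (r x) (l y) ≡ isZero y ∧ (x ==F v)
  attach-rl x y rewrite splitAt-↑ʳ (size H) (size G) x | splitAt-↑ˡ (size H) y (size G) = refl

-- `attach` recognises the centre by `isZero`, so the induction must also carry that the centre, and
-- no vertex of a part, is zero.
SL-join : ∀ k Ts vs → Σ (Join (SL k Ts vs) Ts vs) λ J →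
          isZero (Join.w J) ≡ true × (∀ i x → isZero (Join.e J i x) ≡ false)
SL-join zero Ts vs = record
  { w = zero ; e = λ () ; cover = λ { zero → inj₁ refl } ; e-inj = λ { {()} } ; e≢w = λ { {()} }
  ; adj-ww = refl ; adj-we = λ () ; adj-ew = λ () ; adj-ee = λ () ; adj-≢ = λ { {()} } }
  , refl , λ ()
SL-join (suc k) Ts vs with SL-join k (Ts ∘ suc) (vs ∘ suc)
... | J , wz , ez = record
  { w = w ↑ˡ m ; e = e′ ; cover = cover′
  ; e-inj = λ {i} {j} {x} {y} → e′-inj i j x y
  ; e≢w = λ {i} {x} → e′≢w i x
  ; adj-ww = trans (attach-ll H G v _ _) adj-ww
  ; adj-we = λ { zero x → trans (attach-lr H G v _ x) (cong (_∧ (x ==F v)) wz)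
               ; (suc i) x → trans (attach-ll H G v _ _) (adj-we i x) }
  ; adj-ew = λ { zero x → trans (attach-rl H G v x _) (cong (_∧ (x ==F v)) wz)
               ; (suc i) x → trans (attach-ll H G v _ _) (adj-ew i x) }
  ; adj-ee = λ { zero x y → attach-rr H G v x y
               ; (suc i) x y → trans (attach-ll H G v _ _) (adj-ee i x y) }
  ; adj-≢ = λ {i} {j} → e′-≢ i j }
  , trans (isZero-↑ˡ w m) wz
  , λ { zero x → isZero-↑ʳ x w ; (suc i) x → trans (isZero-↑ˡ (e i x) m) (ez i x) }
  where
  open Join J
  H = SL k (Ts ∘ suc) (vs ∘ suc)
  G = Ts zero
  v = vs zero
  m = size G
  e′ : ∀ i → Fin (size (Ts i)) → Fin (size H + m)
  e′ zero    x = size H ↑ʳ x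
  e′ (suc i) x = e i x ↑ˡ m
  cover′ : ∀ z → z ≡ w ↑ˡ m ⊎ ∃₂ λ i x → z ≡ e′ i x
  cover′ z with splitAt (size H) z in eq
  ... | inj₂ y = inj₂ (zero , y , sym (splitAt⁻¹-↑ʳ eq))
  ... | inj₁ y with cover y
  ...   | inj₁ p           = inj₁ (trans (sym (splitAt⁻¹-↑ˡ eq)) (cong (_↑ˡ m) p))
  ...   | inj₂ (i , x , p) = inj₂ (suc i , x , trans (sym (splitAt⁻¹-↑ˡ eq)) (cong (_↑ˡ m) p))
  e′-inj : ∀ i j x y → e′ i x ≡ e′ j y → _≡_ {A = Part Ts} (i , x) (j , y)
  e′-inj zero zero x y p with ↑ʳ-injective (size H) x y p
  ... | refl = refl
  e′-inj zero (suc j) x y p = ⊥-elim (↑ˡ≢↑ʳ (e j y) x (sym p))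
  e′-inj (suc i) zero x y p = ⊥-elim (↑ˡ≢↑ʳ (e i x) y p)
  e′-inj (suc i) (suc j) x y p with e-inj (↑ˡ-injective m (e i x) (e j y) p)
  ... | refl = refl
  e′≢w : ∀ i x → e′ i x ≢ w ↑ˡ m
  e′≢w zero    x p = ↑ˡ≢↑ʳ w x (sym p)
  e′≢w (suc i) x p = e≢w (↑ˡ-injective m (e i x) w p)
  e′-≢ : ∀ i j x y → i ≢ j → adj (attach H G v) (e′ i x) (e′ j y) ≡ false
  e′-≢ zero zero x y n = ⊥-elim (n refl)
  e′-≢ zero (suc j) x y n = trans (attach-rl H G v x _) (cong (_∧ (x ==F v)) (ez j y))
  e′-≢ (suc i) zero x y n = trans (attach-lr H G v _ y) (cong (_∧ (y ==F v)) (ez i x))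
  e′-≢ (suc i) (suc j) x y n = trans (attach-ll H G v _ _) (adj-≢ x y (n ∘ cong suc))

count-++ : ∀ m n (f : Fin (m + n) → Bool) →
           count f ≡ count {m} (λ x → f (x ↑ˡ n)) + count (λ y → f (m ↑ʳ y))
count-++ zero    n f = refl
count-++ (suc m) n f = trans (cong (ind (f zero) +_) (count-++ m n (f ∘ suc)))
                             (sym (ℕ.+-assoc (ind (f zero)) _ _))

count-SL : ∀ k Ts vs (f : V (SL k Ts vs) → Bool) → let open Join (proj₁ (SL-join k Ts vs)) in
           count f ≡ ind (f w) + sum (λ i → count (λ x → f (e i x)))
count-SL zero Ts vs f = refl
count-SL (suc k) Ts vs f with SL-join k (Ts ∘ suc) (vs ∘ suc) | count-SL k (Ts ∘ suc) (vs ∘ suc)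
... | J , _ , _ | ih = begin
  count f                                          ≡⟨ count-++ (size H) m f ⟩
  count (λ x → f (x ↑ˡ m)) + c                     ≡⟨ cong (_+ c) (ih (λ x → f (x ↑ˡ m))) ⟩
  ind (f (Join.w J ↑ˡ m)) + rest + c               ≡⟨ ℕ.+-assoc (ind (f (Join.w J ↑ˡ m))) rest c ⟩
  ind (f (Join.w J ↑ˡ m)) + (rest + c)             ≡⟨ cong (ind (f (Join.w J ↑ˡ m)) +_) (ℕ.+-comm rest c) ⟩
  ind (f (Join.w J ↑ˡ m)) + (c + rest)             ∎
  where
  open ≡-Reasoning
  H = SL k (Ts ∘ suc) (vs ∘ suc)
  m = size (Ts zero)
  c = count (λ y → f (size H ↑ʳ y))
  rest = sum (λ i → count (λ x → f (Join.e J i x ↑ˡ m)))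

count-iso : ∀ {G H} (I : Iso G H) (f : V H → Bool) → count f ≡ count (f ∘ Iso.to I)
count-iso I f = ℕ.≤-antisym
  (count-inj-≤ f (f ∘ to) from (λ x p → trans (cong f (to∘from x)) p)
    (λ x y _ _ p → trans (sym (to∘from x)) (trans (cong to p) (to∘from y))))
  (count-inj-≤ (f ∘ to) f to (λ _ p → p)
    (λ x y _ _ p → trans (sym (from∘to x)) (trans (cong from p) (from∘to y))))
  where open Iso I

-- Counts are invariant under isomorphism, and in `SL` the vertices are literally concatenated.
count-join : ∀ {T k} {Ts : Fin k → Graph} {vs} (J : Join T Ts vs) (f : V T → Bool) → let open Join J in
             count f ≡ ind (f w) + sum (λ i → count (λ x → f (e i x)))
count-join {T} {k} {Ts} {vs} J f = trans (count-iso (join-iso K J) f)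
  (trans (count-SL k Ts vs (f ∘ join-map K J))
    (cong₂ _+_ (cong (ind ∘ f) (join-map-w K J))
      (sum-cong-≗ (λ i → count-cong (λ x → cong f (join-map-e K J i x))))))
  where K = proj₁ (SL-join k Ts vs)

-- Tight trees

-- Stated for every locating-dominating set, so that minimum sets of the parts never have to be
-- found.
Tight : Graph → Set
Tight G = ∀ S → IsLD G S → size G + ℓ G ≤ 2 * count S + s G + sl G

acyclic-embed : ∀ {G H : Graph} (f : V G → V H) → (∀ {x y} → f x ≡ f y → x ≡ y) →
                (∀ x y → adj H (f x) (f y) ≡ adj G x y) → (Cycle H → ⊥) → Cycle G → ⊥
acyclic-embed f inj pres acyc C = acyc record
  { m = m ; c = f ∘ c ; inj = λ p → Cycle.inj C (inj p)
  ; cons = λ i → trans (pres _ _) (cons i) ; close = trans (pres _ _) close }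
  where open Cycle C using (m; c; cons; close)

-- Leaves, support vertices and locating-dominating sets of a join and its parts

module Joined {T : Graph} (tree : IsTree T) {k : ℕ} {Ts : Fin k → Graph}
  {vs : ∀ i → Fin (size (Ts i))} (J : Join T Ts vs) where
  open Join J
  open IsTree tree
  open Tree T tree

  e-inj′ : ∀ {i x y} → e i x ≡ e i y → x ≡ y
  e-inj′ p with e-inj p
  ... | refl = refl

  adj-w : ∀ {i x} → Adj T (e i x) w → x ≡ vs i
  adj-w {i} {x} a = ==F⁻ (trans (sym (adj-ew i x)) a)

  adj-vw : ∀ i → Adj T (e i (vs i)) w
  adj-vw i = trans (adj-ew i (vs i)) (==F-refl (vs i))

  lift : ∀ {i x y} → Adj (Ts i) x y → Adj T (e i x) (e i y)
  lift {i} {x} {y} a = trans (adj-ee i x y) a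

  lower : ∀ {i x y} → Adj T (e i x) (e i y) → Adj (Ts i) x y
  lower {i} {x} {y} a = trans (sym (adj-ee i x y)) a

  nbr-of-e : ∀ {i x z} → Adj T (e i x) z → (z ≡ w × x ≡ vs i) ⊎ ∃ λ y → z ≡ e i y × Adj (Ts i) x y
  nbr-of-e {i} {x} {z} a with cover z
  ... | inj₁ refl = inj₁ (refl , adj-w a)
  ... | inj₂ (j , y , refl) with i ≟ j
  ...   | yes refl = inj₂ (y , refl , lower a)
  ...   | no i≢j   = clash a (adj-≢ x y i≢j)

  nbr-of-w : ∀ {z} → Adj T w z → ∃ λ i → z ≡ e i (vs i)
  nbr-of-w {z} a with cover z
  ... | inj₁ refl = adj-irrefl a
  ... | inj₂ (i , x , refl) = i , cong (e i) (adj-w (adj-sym a))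

  -- Everything outside part `i` collapses to `vs i`. Edges go to edges or points, so walks of `T`
  -- project and the part is connected.
  retract : ∀ i → V T → Fin (size (Ts i))
  retract i z with cover z
  ... | inj₁ _ = vs i
  ... | inj₂ (j , y , _) with j ≟ i
  ...   | yes refl = y
  ...   | no _     = vs i

  retract-e : ∀ i x → retract i (e i x) ≡ x
  retract-e i x with cover (e i x)
  ... | inj₁ p = ⊥-elim (e≢w p)
  ... | inj₂ (j , y , p) with e-inj p
  ...   | refl with i ≟ i
  ...     | yes refl = refl
  ...     | no n     = ⊥-elim (n refl)

  retract-w : ∀ i → retract i w ≡ vs i
  retract-w i with cover w
  ... | inj₁ _ = refl
  ... | inj₂ (j , y , p) = ⊥-elim (e≢w (sym p))

  retract-other : ∀ i j y → j ≢ i → retract i (e j y) ≡ vs i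
  retract-other i j y n with cover (e j y)
  ... | inj₁ p = ⊥-elim (e≢w p)
  ... | inj₂ (j′ , y′ , p) with e-inj p
  ...   | refl with j ≟ i
  ...     | yes m = ⊥-elim (n m)
  ...     | no _  = refl

  retract-adj : ∀ i {y z} → Adj T y z →
                retract i y ≡ retract i z ⊎ Adj (Ts i) (retract i y) (retract i z)
  retract-adj i {y} {z} a = from-cover (cover y) a
    where
    from-cover : y ≡ w ⊎ (∃₂ λ j x → y ≡ e j x) → Adj T y z →
                 retract i y ≡ retract i z ⊎ Adj (Ts i) (retract i y) (retract i z)
    from-cover (inj₁ refl) a with nbr-of-w a
    ... | j , refl with j ≟ i
    ...   | yes refl = inj₁ (trans (retract-w i) (sym (retract-e i (vs i))))
    ...   | no n     = inj₁ (trans (retract-w i) (sym (retract-other i j _ n)))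
    from-cover (inj₂ (j , x , refl)) a with nbr-of-e a | j ≟ i
    ... | inj₁ (refl , refl)  | yes refl = inj₁ (trans (retract-e i x) (sym (retract-w i)))
    ... | inj₁ (refl , refl)  | no n     = inj₁ (trans (retract-other i j x n) (sym (retract-w i)))
    ... | inj₂ (u , refl , b) | yes refl =
      inj₂ (subst₂ (Adj (Ts i)) (sym (retract-e i x)) (sym (retract-e i u)) b)
    ... | inj₂ (u , refl , b) | no n     =
      inj₁ (trans (retract-other i j x n) (sym (retract-other i j u n)))

  retract-walk : ∀ i {y z} → Walk T y z → Walk (Ts i) (retract i y) (retract i z)
  retract-walk i here = here
  retract-walk i {z = z} (step a p) with retract-adj i a
  ... | inj₁ q = subst (λ u → Walk (Ts i) u (retract i z)) (sym q) (retract-walk i p)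
  ... | inj₂ b = step b (retract-walk i p)

  part-tree : ∀ i → IsTree (Ts i)
  part-tree i = record
    { symm = λ x y → trans (sym (adj-ee i x y)) (trans (symm _ _) (adj-ee i y x))
    ; irrefl = λ x → trans (sym (adj-ee i x x)) (irrefl _)
    ; nonempty = ℕ.≤-trans (s≤s z≤n) (toℕ<n (vs i))
    ; connected = λ x y → subst₂ (Walk (Ts i)) (retract-e i x) (retract-e i y)
                            (retract-walk i (connected (e i x) (e i y)))
    ; acyclic = acyclic-embed (e i) e-inj′ (adj-ee i) acyclic }

  part-size-< : ∀ i → size (Ts i) < size T
  part-size-< i = subst₂ _≤_ (count-true (suc (size (Ts i)))) (count-true (size T))
    (count-inj-≤ {suc (size (Ts i))} (λ _ → true) (λ _ → true) φ (λ _ _ → refl)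
      λ x y _ _ → φ-inj x y)
    where
    φ : Fin (suc (size (Ts i))) → V T
    φ zero    = w
    φ (suc x) = e i x
    φ-inj : ∀ x y → φ x ≡ φ y → x ≡ y
    φ-inj zero    zero    _ = refl
    φ-inj zero    (suc y) p = ⊥-elim (e≢w (sym p))
    φ-inj (suc x) zero    p = ⊥-elim (e≢w p)
    φ-inj (suc x) (suc y) p = cong suc (e-inj′ p)

  -- The distinct indices certify two parts. Thus the centre is not pendant, and it can be told
  -- apart from any vertex of a part.
  module Supported (sup : ∀ i → Support (Ts i) (vs i)) (a b : Fin k) (a≢b : a ≢ b) where

    other : ∀ i → ∃ λ j → i ≢ j
    other i with i ≟ a
    ... | yes refl = b , a≢b
    ... | no n     = a , n

    v-not-leaf : ∀ i → ¬ Leaf (Ts i) (vs i)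
    v-not-leaf i = Tree.support-not-leaf (Ts i) (part-tree i) (sup i)

    v-not-pendant : ∀ i → ¬ Pendant T (e i (vs i))
    v-not-pendant i p with support⁻ (Ts i) (vs i) (sup i)
    ... | y , vy , _ = e≢w (pendant-unique T p (lift vy) (adj-vw i))

    w-not-pendant : ¬ Pendant T w
    w-not-pendant p with e-inj (pendant-unique T p (adj-sym (adj-vw a)) (adj-sym (adj-vw b)))
    ... | q = a≢b (cong proj₁ q)

    pendant-lift : ∀ {i x} → x ≢ vs i → Pendant (Ts i) x → Pendant T (e i x)
    pendant-lift {i} {x} x≢v (u , xu , only) = e i u , lift xu , only′
      where
      only′ : ∀ z → Adj T (e i x) z → z ≡ e i u
      only′ z p with nbr-of-e p
      ... | inj₁ (_ , q)        = ⊥-elim (x≢v q)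
      ... | inj₂ (y , refl , q) = cong (e i) (only y q)

    pendant-lower : ∀ {i x} → Pendant T (e i x) → Pendant (Ts i) x
    pendant-lower {i} {x} (z , xz , only) with nbr-of-e xz
    ... | inj₁ (_ , refl)      = ⊥-elim (v-not-pendant i (z , xz , only))
    ... | inj₂ (u , refl , xu) = u , xu , λ y xy → e-inj′ (only (e i y) (lift xy))

    -- The centre would have to be one of the two, yet it is not pendant. Hence the convention for
    -- `P₂` never acts in `T`.
    no-pendant-pair : ∀ {i x z} → Adj T (e i x) z → Pendant T (e i x) → Pendant T z → ⊥
    no-pendant-pair xz p q with pendant-pair xz p q w
    ... | inj₁ r    = e≢w (sym r)
    ... | inj₂ refl = w-not-pendant q

    leaf-lower : ∀ {i x} → Leaf T (e i x) → Leaf (Ts i) x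
    leaf-lower {i} {x} l = leaf⁺ (Ts i) x px before
      where
      px : Pendant (Ts i) x
      px = pendant-lower (leaf-pendant T l)
      before : ∀ u → Adj (Ts i) x u → Pendant (Ts i) u → toℕ u < toℕ x
      before u xu pu with u ≟ vs i
      ... | no n = ⊥-elim (no-pendant-pair (lift xu) (leaf-pendant T l) (pendant-lift n pu))
      -- Here the part is `P₂`. As `vs i` is its support vertex, the leaf next to `vs i` can only be
      -- `x`.
      ... | yes refl with support⁻ (Ts i) (vs i) (sup i)
      ...   | y , vy , ly with pendant-unique (Ts i) pu vy (Tree.adj-sym (Ts i) (part-tree i) xu)
      ...     | refl = proj₂ (leaf⁻ (Ts i) x ly) u xu pu

    leaf-lift : ∀ {i x} → Leaf (Ts i) x → Leaf T (e i x)
    leaf-lift {i} {x} l = leaf⁺ T (e i x) px (λ z xz pz → ⊥-elim (no-pendant-pair xz px pz))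
      where
      px : Pendant T (e i x)
      px = pendant-lift (λ { refl → v-not-leaf i l }) (leaf-pendant (Ts i) l)

    support-lift : ∀ {i x} → Support (Ts i) x → Support T (e i x)
    support-lift {i} {x} p with support⁻ (Ts i) x p
    ... | y , xy , ly = support⁺ T (lift xy) (leaf-lift ly)

    support-lower : ∀ {i x} → Support T (e i x) → Support (Ts i) x
    support-lower {i} {x} p with support⁻ T (e i x) p
    ... | z , xz , lz with nbr-of-e xz
    ...   | inj₁ (refl , _)      = ⊥-elim (w-not-pendant (leaf-pendant T lz))
    ...   | inj₂ (y , refl , xy) = support⁺ (Ts i) xy (leaf-lower lz)

    w-not-support : ¬ Support T w
    w-not-support p with support⁻ T w p
    ... | z , wz , lz with nbr-of-w wz
    ...   | i , refl = v-not-pendant i (leaf-pendant T lz)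

    w-slink : SLink T w
    w-slink = slink⁺ T w (w-not-pendant ∘ leaf-pendant T) w-not-support nbrs
      where
      nbrs : ∀ z → Adj T w z → Support T z
      nbrs z wz with nbr-of-w wz
      ... | i , refl = support-lift (sup i)

    slink-lift : ∀ {i x} → SLink (Ts i) x → SLink T (e i x)
    slink-lift {i} {x} p with slink⁻ (Ts i) x p
    ... | nl , ns , all = slink⁺ T (e i x) (nl ∘ leaf-lower) (ns ∘ support-lower) nbrs
      where
      nbrs : ∀ z → Adj T (e i x) z → Support T z
      nbrs z xz with nbr-of-e xz
      ... | inj₁ (_ , refl)      = ⊥-elim (ns (sup i))
      ... | inj₂ (y , refl , xy) = support-lift (all y xy)

    slink-lower : ∀ {i x} → SLink T (e i x) → SLink (Ts i) x
    slink-lower {i} {x} p with slink⁻ T (e i x) p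
    ... | nl , ns , all = slink⁺ (Ts i) x (nl ∘ leaf-lift) (ns ∘ support-lift)
                            (λ y xy → support-lower (all (e i y) (lift xy)))

    count-parts : ∀ {f} {b} (g : ∀ i → V (Ts i) → Bool) → f w ≡ b → (∀ i x → f (e i x) ≡ g i x) →
                  count f ≡ ind b + sum (λ i → count (g i))
    count-parts {f} g p q = trans (count-join J f)
      (cong₂ _+_ (cong ind p) (sum-cong-≗ {k} (λ i → count-cong (q i))))

    size-T : size T ≡ 1 + sum (λ i → size (Ts i))
    size-T = trans (sym (count-true (size T))) (trans (count-join J (λ _ → true))
      (cong suc (sum-cong-≗ (λ i → count-true (size (Ts i))))))

    ℓ-T : ℓ T ≡ sum (λ i → ℓ (Ts i))
    ℓ-T = count-parts (λ i → isLeaf (Ts i)) (¬-not (w-not-pendant ∘ leaf-pendant T))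
            (λ i x → iff⇒≡ leaf-lower leaf-lift)

    s-T : s T ≡ sum (λ i → s (Ts i))
    s-T = count-parts (λ i → isSupport (Ts i)) (¬-not w-not-support)
            (λ i x → iff⇒≡ support-lower support-lift)

    sl-T : sl T ≡ 1 + sum (λ i → sl (Ts i))
    sl-T = count-parts (λ i → isSupportLink (Ts i)) w-slink (λ i x → iff⇒≡ slink-lower slink-lift)

    order+leaves : (λ i → size (Ts i) + ℓ (Ts i)) sumsTo (sum (λ i → size (Ts i)) + sum (λ i → ℓ (Ts i)))
    order+leaves = sum-+ (total refl) (total refl)

    weight : (c : Fin k → ℕ) → (λ i → 2 * c i + s (Ts i) + sl (Ts i)) sumsTo
             (2 * sum c + sum (λ i → s (Ts i)) + sum (λ i → sl (Ts i)))
    weight c = sum-+ (sum-+ (sum-double (total refl)) (total refl)) (total refl)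

    order+leaves-T : size T + ℓ T ≡ suc (sum (λ i → size (Ts i) + ℓ (Ts i)))
    order+leaves-T = trans (cong₂ _+_ size-T ℓ-T) (cong suc (sym (sum≡ order+leaves)))

    weight-T : ∀ c → 2 * sum c + s T + sl T ≡ suc (sum (λ i → 2 * c i + s (Ts i) + sl (Ts i)))
    weight-T c = trans (cong₂ _+_ (cong (2 * sum c +_) s-T) sl-T)
      (trans (ℕ.+-suc _ _) (cong suc (sym (sum≡ (weight c)))))

    -- The centre is adjacent only to the selected vertices `vs i`, so it neither dominates nor
    -- separates unselected vertices of a part.
    restrict-LD : ∀ S → IsLD T S → (∀ i → S (e i (vs i)) ≡ true) → ∀ i → IsLD (Ts i) (λ x → S (e i x))
    restrict-LD S ld v∈S i = record { dominating = dom ; locating = loc }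
      where
      open IsLD ld
      dom : ∀ u → S (e i u) ≡ false → ∃ λ x → S (e i x) ≡ true × Adj (Ts i) u x
      dom u p with dominating (e i u) p
      ... | z , z∈S , uz with nbr-of-e uz
      ...   | inj₁ (_ , refl)      = clash (v∈S i) p
      ...   | inj₂ (y , refl , uy) = y , z∈S , uy
      far-w : ∀ {u} → S (e i u) ≡ false → adj T (e i u) w ≡ false
      far-w {u} p = ¬-not λ q → case adj-w q of λ { refl → clash (v∈S i) p }
      loc : ∀ u v → S (e i u) ≡ false → S (e i v) ≡ false → u ≢ v →
            ∃ λ x → S (e i x) ≡ true × adj (Ts i) u x ≢ adj (Ts i) v x
      loc u v p q u≢v with locating (e i u) (e i v) p q (u≢v ∘ e-inj′)
      ... | z , z∈S , ne with cover z
      ...   | inj₁ refl = ⊥-elim (ne (trans (far-w p) (sym (far-w q))))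
      ...   | inj₂ (j , y , refl) with i ≟ j
      ...     | yes refl = y , z∈S , λ r → ne (trans (adj-ee i u y) (trans r (sym (adj-ee i v y))))
      ...     | no i≢j   = ⊥-elim (ne (trans (adj-≢ u y i≢j) (sym (adj-≢ v y i≢j))))

    union : (∀ i → V (Ts i) → Bool) → V T → Bool
    union S z with cover z
    ... | inj₁ _           = false
    ... | inj₂ (i , x , _) = S i x

    union-w : ∀ S → union S w ≡ false
    union-w S with cover w
    ... | inj₁ _ = refl
    ... | inj₂ (i , x , p) = ⊥-elim (e≢w (sym p))

    union-e : ∀ S i x → union S (e i x) ≡ S i x
    union-e S i x with cover (e i x)
    ... | inj₁ p = ⊥-elim (e≢w p)
    ... | inj₂ (j , y , p) with e-inj p
    ...   | refl = refl

    count-union : ∀ S → count (union S) ≡ sum (λ i → count (S i))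
    count-union S = count-parts S (union-w S) (union-e S)

    -- The centre differs from a vertex of part `i` at `vs j` for another part `j`. Vertices of
    -- different parts differ at a dominator of one of them, which lies in its own part.
    union-LD : ∀ S → (∀ i → IsLD (Ts i) (S i)) → (∀ i → S i (vs i) ≡ true) → IsLD T (union S)
    union-LD S ld v∈S = record { dominating = dom ; locating = loc }
      where
      v∈U : ∀ i → union S (e i (vs i)) ≡ true
      v∈U i = trans (union-e S i (vs i)) (v∈S i)
      dom : ∀ z → union S z ≡ false → ∃ λ y → union S y ≡ true × Adj T z y
      dom z p with cover z
      ... | inj₁ refl = e a (vs a) , v∈U a , adj-sym (adj-vw a)
      ... | inj₂ (i , x , refl) with IsLD.dominating (ld i) x p
      ...   | y , y∈S , xy = e i y , trans (union-e S i y) y∈S , lift xy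
      far : ∀ {i x} → S i x ≡ false → ∀ j → i ≢ j →
            ∃ λ y → union S y ≡ true × adj T w y ≢ adj T (e i x) y
      far {i} {x} p j i≢j = e j (vs j) , v∈U j , λ q →
        clash (adj-sym (adj-vw j)) (trans q (adj-≢ x (vs j) i≢j))
      loc : ∀ u v → union S u ≡ false → union S v ≡ false → u ≢ v →
            ∃ λ y → union S y ≡ true × adj T u y ≢ adj T v y
      loc u v p q u≢v with cover u | cover v
      ... | inj₁ refl | inj₁ refl = ⊥-elim (u≢v refl)
      ... | inj₁ refl | inj₂ (i , x , refl) = far q (proj₁ (other i)) (proj₂ (other i))
      ... | inj₂ (i , x , refl) | inj₁ refl with far {i} {x} p (proj₁ (other i)) (proj₂ (other i))
      ...   | y , y∈S , ne = y , y∈S , ne ∘ sym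
      loc u v p q u≢v | inj₂ (i , x , refl) | inj₂ (j , x′ , refl) with i ≟ j
      ...   | yes refl with IsLD.locating (ld i) x x′ p q (u≢v ∘ cong (e i))
      ...     | y , y∈S , ne = e i y , trans (union-e S i y) y∈S ,
                λ r → ne (trans (sym (adj-ee i x y)) (trans r (adj-ee i x′ y)))
      loc u v p q u≢v | inj₂ (i , x , refl) | inj₂ (j , x′ , refl) | no i≢j
        with IsLD.dominating (ld i) x p
      ...     | y , y∈S , xy = e i y , trans (union-e S i y) y∈S ,
                λ r → clash (lift xy) (trans r (adj-≢ x′ y (i≢j ∘ sym)))

    tight-join : (∀ i → Tight (Ts i)) → Tight T
    tight-join tight S ld with select-supports T tree (λ i → e i (vs i)) (λ i → support-lift (sup i)) S ld
    ... | S′ , ld′ , le , v∈S′ = ℕ.≤-trans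
      (subst₂ _≤_ (sym order+leaves-T) (sym (weight-T inside))
        (s≤s (sum-mono-≤ (λ i → tight i _ (restrict-LD S′ ld′ v∈S′ i)))))
      -- The centre may belong to `S′`; dropping it only lowers the count.
      (ℕ.+-monoˡ-≤ (sl T) (ℕ.+-monoˡ-≤ (s T) (ℕ.*-monoʳ-≤ 2 (ℕ.≤-trans
        (subst (sum inside ≤_) (sym (count-join J S′)) (ℕ.m≤n+m (sum inside) (ind (S′ w)))) le))))
      where
      inside : Fin k → ℕ
      inside i = count (λ x → S′ (e i x))

    part-neighbour : ∀ i x → ∃ λ y → Adj (Ts i) x y
    part-neighbour i x with support⁻ (Ts i) (vs i) (sup i) | x ≟ vs i
    ... | y , vy , _ | yes refl = y , vy
    ... | _          | no n     = Tree.neighbour (Ts i) (part-tree i) n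

    -- The given set is glued with sparse sets in all other parts. These obey the upper bound, so
    -- `sum-tight` leaves the lower bound at part `i`.
    tight-part : Tight T → ∀ i → Tight (Ts i)
    tight-part tight i S ld with select-supports (Ts i) (part-tree i) {1} (λ _ → vs i) (λ _ → sup i) S ld
    ... | S′ , ld′ , le , v∈S′ = ℕ.≤-trans
      (subst (λ c → size (Ts i) + ℓ (Ts i) ≤ 2 * c + s (Ts i) + sl (Ts i)) at-i
        (sum-tight i bound (ℕ.≤-pred (subst₂ _≤_ order+leaves-T (weight-T (λ j → count (F j)))
          (subst (λ c → size T + ℓ T ≤ 2 * c + s T + sl T) (count-union F)
            (tight (union F) (union-LD F F-LD F-v)))))))
      (ℕ.+-monoˡ-≤ (sl (Ts i)) (ℕ.+-monoˡ-≤ (s (Ts i)) (ℕ.*-monoʳ-≤ 2 le)))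
      where
      best : ∀ j → ∃ (Sparse (Ts j))
      best j = UpperBound.sparse (Ts j) (part-tree j) (part-neighbour j)
      F : ∀ j → V (Ts j) → Bool
      F j with j ≟ i
      ... | yes refl = S′
      ... | no _     = proj₁ (best j)
      F-LD : ∀ j → IsLD (Ts j) (F j)
      F-LD j with j ≟ i
      ... | yes refl = ld′
      ... | no _     = proj₁ (proj₂ (best j))
      F-v : ∀ j → F j (vs j) ≡ true
      F-v j with j ≟ i
      ... | yes refl = v∈S′ zero
      ... | no _     = proj₁ (proj₂ (proj₂ (best j))) (vs j) (sup j)
      at-i : count (F i) ≡ count S′
      at-i with i ≟ i
      ... | yes refl = refl
      ... | no n     = ⊥-elim (n refl)
      bound : ∀ j → j ≢ i → 2 * count (F j) + s (Ts j) + sl (Ts j) ≤ size (Ts j) + ℓ (Ts j)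
      bound j n with j ≟ i
      ... | yes r = ⊥-elim (n r)
      ... | no _  = proj₂ (proj₂ (proj₂ (best j)))

-- Decomposition of a tree into the branches at a vertex

module Branches (T : Graph) (tree : IsTree T) (w : V T) where
  open Tree T tree
  open Rooted T tree w

  -- Total, with a junk value at the root.
  findParent : ∀ x n → depth x ≡ n → ∃ λ y → ∀ {m} → n ≡ suc m → Adj T x y × depth y ≡ m
  findParent x zero    e = x , λ ()
  findParent x (suc n) e = proj₁ (upper x e) , λ { refl → proj₂ (upper x e) }

  parent : V T → V T
  parent x = proj₁ (findParent x (depth x) refl)

  parent-spec : ∀ x {m} → depth x ≡ suc m → Adj T x (parent x) × depth (parent x) ≡ m
  parent-spec x = proj₂ (findParent x (depth x) refl)

  ascendant : ℕ → V T → V T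
  ascendant zero    x = x
  ascendant (suc m) x = ascendant m (parent x)

  -- The neighbour of w through which x is reached; junk for x = w.
  branch : V T → V T
  branch x = ascendant (pred (depth x)) x

  depth-≢w : ∀ {x} → x ≢ w → ∃ λ m → depth x ≡ suc m
  depth-≢w {x} n with depth x in d
  ... | zero  = ⊥-elim (n (depth-zero x d))
  ... | suc m = m , refl

  branch-nbr : ∀ {x} → Adj T w x → branch x ≡ x
  branch-nbr {x} a with depth-step a
  ... | inj₁ d = case trans (sym depth-root) d of λ ()
  ... | inj₂ d = cong (λ m → ascendant (pred m) x) (trans d (cong suc depth-root))

  parent-of-child : ∀ {x y} → Adj T y x → depth y ≡ suc (depth x) → parent y ≡ x
  parent-of-child {x} {y} a d with parent-spec y d
  ... | b , q = upper-unique b a (below (ℕ.≤-reflexive q)) (below ℕ.≤-refl)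
    where
    below : ∀ {m} → m ≤ depth x → m ≤ depth y
    below le = ℕ.≤-trans le (ℕ.≤-trans (ℕ.n≤1+n _) (ℕ.≤-reflexive (sym d)))

  branch-child : ∀ {x y} → x ≢ w → Adj T y x → depth y ≡ suc (depth x) → branch y ≡ branch x
  branch-child {x} {y} n a d with depth-≢w n
  ... | m , e = begin
    ascendant (pred (depth y)) y ≡⟨ cong (λ m → ascendant (pred m) y) (trans d (cong suc e)) ⟩
    ascendant m (parent y)       ≡⟨ cong (ascendant m) (parent-of-child a d) ⟩
    ascendant m x                ≡⟨ cong (λ m → ascendant (pred m) x) e ⟨
    ascendant (pred (depth x)) x ∎
    where open ≡-Reasoning

  -- One of the two is the parent of the other, so both ascend to the same neighbour of `w`.
  branch-adj : ∀ {x y} → x ≢ w → y ≢ w → Adj T x y → branch x ≡ branch y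
  branch-adj x≢w y≢w a with depth-step a
  ... | inj₁ d = branch-child y≢w a d
  ... | inj₂ d = sym (branch-child x≢w (adj-sym a) d)

  w-adj-branch : ∀ {x} → x ≢ w → Adj T w (branch x)
  w-adj-branch {x} n with depth-≢w n
  ... | m , e = subst (λ m → Adj T w (ascendant (pred m) x)) (sym e) (top m x e)
    where
    top : ∀ m x → depth x ≡ suc m → Adj T w (ascendant m x)
    top m x e with parent-spec x e
    top zero    x e | a , q = adj-sym (subst (Adj T x) (depth-zero (parent x) q) a)
    top (suc m) x e | a , q = top m (parent x) q

  k : ℕ
  k = deg T w

  nb : Fin k → V T
  nb = proj₁ (enum (adj T w))

  w-nb : ∀ i → Adj T w (nb i)
  w-nb = proj₁ (proj₂ (enum (adj T w)))

  nb-inj : ∀ i j → nb i ≡ nb j → i ≡ j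
  nb-inj = proj₁ (proj₂ (proj₂ (enum (adj T w))))

  nb-onto : ∀ z → Adj T w z → ∃ λ i → nb i ≡ z
  nb-onto = proj₂ (proj₂ (proj₂ (enum (adj T w))))

  rest : Fin k → V T → Bool
  rest i z = not (z ==F w) ∧ (branch z ==F nb i) ∧ not (z ==F nb i)

  -- nb i comes first, so that it is the support vertex if its branch is P₂.
  e : ∀ i → Fin (suc (count (rest i))) → V T
  e i zero    = nb i
  e i (suc x) = proj₁ (enum (rest i)) x

  rest⁻ : ∀ i x → e i (suc x) ≢ w × branch (e i (suc x)) ≡ nb i × e i (suc x) ≢ nb i
  rest⁻ i x with ∧⁻ {not (e i (suc x) ==F w)} (proj₁ (proj₂ (enum (rest i))) x)
  ... | p , q with ∧⁻ {branch (e i (suc x)) ==F nb i} q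
  ...   | r , t = (λ u → clash (≡⇒==F u) (not⁻ p)) , ==F⁻ r , (λ u → clash (≡⇒==F u) (not⁻ t))
    where
    ≡⇒==F : ∀ {n} {x y : Fin n} → x ≡ y → x ==F y ≡ true
    ≡⇒==F {x = x} refl = ==F-refl x

  e≢w : ∀ i x → e i x ≢ w
  e≢w i zero    p = adj⇒≢ (w-nb i) (sym p)
  e≢w i (suc x) = proj₁ (rest⁻ i x)

  branch-e : ∀ i x → branch (e i x) ≡ nb i
  branch-e i zero    = branch-nbr (w-nb i)
  branch-e i (suc x) = proj₁ (proj₂ (rest⁻ i x))

  e-onto : ∀ i z → z ≢ w → branch z ≡ nb i → ∃ λ x → z ≡ e i x
  e-onto i z z≢w p with z ≟ nb i
  ... | yes q = zero , q
  ... | no n with proj₂ (proj₂ (proj₂ (enum (rest i)))) z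
                    (∧⁺ (not⁺ (==F-≢ z≢w)) (∧⁺ (subst (λ u → branch z ==F u ≡ true) p (==F-refl (branch z)))
                      (not⁺ (==F-≢ n))))
  ...   | x , q = suc x , sym q

  e-inj : ∀ i x y → e i x ≡ e i y → x ≡ y
  e-inj i zero    zero    _ = refl
  e-inj i zero    (suc y) p = ⊥-elim (proj₂ (proj₂ (rest⁻ i y)) (sym p))
  e-inj i (suc x) zero    p = ⊥-elim (proj₂ (proj₂ (rest⁻ i x)) p)
  e-inj i (suc x) (suc y) p = cong suc (proj₁ (proj₂ (proj₂ (enum (rest i)))) x y p)

  Ts : Fin k → Graph
  Ts i = mkGraph (suc (count (rest i))) (λ x y → adj T (e i x) (e i y))

  vs : ∀ i → Fin (size (Ts i))
  vs i = zero

  w-e : ∀ i x → adj T w (e i x) ≡ (x ==F vs i)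
  w-e i zero    = w-nb i
  w-e i (suc x) = ¬-not λ a →
    proj₂ (proj₂ (rest⁻ i x)) (trans (sym (branch-nbr a)) (branch-e i (suc x)))

  join : Join T Ts vs
  join = record
    { w = w ; e = e ; cover = cover ; e-inj = λ {i} {j} {x} {y} → inj i j x y
    ; e≢w = λ {i} {x} → e≢w i x
    ; adj-ww = IsTree.irrefl tree w
    ; adj-we = w-e
    ; adj-ew = λ i x → trans (IsTree.symm tree _ _) (w-e i x)
    ; adj-ee = λ _ _ _ → refl
    ; adj-≢ = λ {i} {j} x y n → ¬-not λ a → n (nb-inj i j
        (trans (sym (branch-e i x)) (trans (branch-adj (e≢w i x) (e≢w j y) a) (branch-e j y)))) }
    where
    cover : ∀ z → z ≡ w ⊎ ∃₂ λ i x → z ≡ e i x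
    cover z with z ≟ w
    ... | yes p = inj₁ p
    ... | no n with nb-onto (branch z) (w-adj-branch n)
    ...   | i , q = inj₂ (i , e-onto i z n (sym q))
    inj : ∀ i j x y → e i x ≡ e j y → _≡_ {A = Part Ts} (i , x) (j , y)
    inj i j x y p with nb-inj i j (trans (sym (branch-e i x)) (trans (cong branch p) (branch-e j y)))
    ... | refl = cong (i ,_) (e-inj i x y p)

  support-branch : ¬ Leaf T w → ∀ i → Support T (nb i) → Support (Ts i) (vs i)
  support-branch nl i p with support⁻ T (nb i) p
  ... | y , a , l with e-onto i y (λ { refl → nl l })
                        (trans (sym (branch-adj (e≢w i zero) (λ { refl → nl l }) a)) (branch-e i zero))
  ...   | zero , refl  = adj-irrefl a
  ...   | suc x , refl = support⁺ (Ts i) {zero} {suc x} a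
          -- Index `zero` precedes `suc x`, so the tie-break makes `suc x` the leaf even if the
          -- branch is `P₂`.
          (leaf⁺ (Ts i) (suc x) (zero , adj-sym a , only)
            λ u b _ → subst (λ z → toℕ z < suc (toℕ x)) (sym (only u b)) z<s)
    where
    only : ∀ u → Adj T (e i (suc x)) (e i u) → u ≡ zero
    only u b = e-inj i u zero (pendant-unique T (leaf-pendant T l) b (adj-sym a))

-- Tightness and membership in the family

fin-pair : ∀ {n} → 2 ≤ n → ∃₂ λ (a b : Fin n) → a ≢ b
fin-pair (s≤s (s≤s _)) = zero , suc zero , λ ()

another : ∀ {n} → 2 ≤ n → (v : Fin n) → ∃ λ u → v ≢ u
another (s≤s (s≤s _)) zero    = suc zero , λ ()
another (s≤s (s≤s _)) (suc v) = zero , λ ()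

module _ {T : Graph} (tree : IsTree T) where
  open Tree T tree

  edge⇒2≤size : ∀ {u v} → Adj T u v → 2 ≤ size T
  edge⇒2≤size {u} {v} a = subst (2 ≤_) (count-true (size T)) (2≤count (λ _ → true) u v refl refl (adj⇒≢ a))

  sparse-LD : 2 ≤ size T → ∃ (Sparse T)
  sparse-LD 2≤n = UpperBound.sparse T tree (λ v → neighbour (proj₂ (another 2≤n v)))

  -- A pendant non-leaf `w` would have a pendant neighbour. That neighbour is a support vertex, and
  -- its leaf could only be `w`.
  slink-nbrs : 2 ≤ size T → ∀ w → SLink T w → 2 ≤ deg T w
  slink-nbrs 2≤n w p with slink⁻ T w p | neighbour (proj₂ (another 2≤n w))
  ... | nl , _ , all | u , wu with any? (λ z → (adj T w z ≟ᵇ true) ×-dec ¬? (u ≟ z))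
  ...   | yes (z , wz , u≢z) = 2≤count (adj T w) u z wu wz u≢z
  ...   | no none = ⊥-elim (nl (leaf⁺ T w pendant λ v wv pv → ⊥-elim (nl (w-leaf v wv pv))))
    where
    pendant : Pendant T w
    pendant = u , wu , λ z wz → sym (decidable-stable (u ≟ z) λ n → none (z , wz , n))
    w-leaf : ∀ v → Adj T w v → Pendant T v → Leaf T w
    w-leaf v wv pv with support⁻ T v (all v wv)
    ... | y , vy , ly = subst (Leaf T) (pendant-unique T pv vy (adj-sym wv)) ly

-- K₁ violates the upper bound 2γ + s + sl ≤ n + ℓ and has to be excluded separately.
2≤order : ∀ {T S} → IsTree T → IsLD T S → 2 * count S ≤ size T + ℓ T → 2 ≤ size T
2≤order {mkGraph zero _} tree ld le with IsTree.nonempty tree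
... | ()
2≤order {mkGraph (suc (suc _)) _} tree ld le = s≤s (s≤s z≤n)
2≤order {T@(mkGraph 1 _)} {S} tree ld le = ⊥-elim (ℕ.<⇒≱ (s≤s (s≤s z≤n))
  (ℕ.≤-trans (ℕ.*-monoʳ-≤ 2 1≤S) (subst (λ l → 2 * count S ≤ 1 + l) no-leaf le)))
  where
  open Tree T tree
  1≤S : 1 ≤ count S
  1≤S with S zero in e
  ... | true  = s≤s z≤n
  ... | false with IsLD.dominating ld zero e
  ...   | zero , p , _ = clash p e
  no-leaf : ℓ T ≡ 0
  no-leaf = cong (λ b → ind b + 0) (¬-not λ l → case leaf-pendant T l of λ { (zero , a , _) → adj-irrefl a })

-- A locating-dominating set is nonempty, and exchanging the two vertices sends leaves to support
-- vertices.
tight-P₂ : ∀ {T} → IsTree T → size T ≡ 2 → Tight T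
tight-P₂ {T@(mkGraph 2 _)} tree refl S ld = ℕ.≤-trans
  (ℕ.+-mono-≤ (ℕ.*-monoʳ-≤ 2 1≤S) ℓ≤s) (ℕ.m≤m+n _ (sl T))
  where
  open Tree T tree
  selected : ∃ λ x → S x ≡ true
  selected with S zero in e
  ... | true  = zero , e
  ... | false with IsLD.dominating ld zero e
  ...   | x , p , _ = x , p
  1≤S : 1 ≤ count S
  1≤S = count-inj-≤ {1} (λ _ → true) S (λ _ → proj₁ selected) (λ _ _ → proj₂ selected)
          λ { zero zero _ _ _ → refl }
  nbr : ∀ v → ∃ λ u → Adj T v u
  nbr v = neighbour (proj₂ (another ℕ.≤-refl v))
  φ : V T → V T
  φ v = proj₁ (nbr v)
  opposite : ∀ z → Adj T zero z → Adj T (suc zero) z → ⊥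
  opposite zero       a _ = adj-irrefl a
  opposite (suc zero) _ a = adj-irrefl a
  φ-inj : ∀ x y → φ x ≡ φ y → x ≡ y
  φ-inj zero       zero       _ = refl
  φ-inj (suc zero) (suc zero) _ = refl
  φ-inj zero       (suc zero) p =
    ⊥-elim (opposite (φ (suc zero)) (subst (Adj T zero) p (proj₂ (nbr zero))) (proj₂ (nbr (suc zero))))
  φ-inj (suc zero) zero       p =
    ⊥-elim (opposite (φ zero) (proj₂ (nbr zero)) (subst (Adj T (suc zero)) p (proj₂ (nbr (suc zero)))))
  ℓ≤s : ℓ T ≤ s T
  ℓ≤s = count-inj-≤ (isLeaf T) (isSupport T) φ
    (λ x l → support⁺ T (adj-sym (proj₂ (nbr x))) l) (λ x y _ _ → φ-inj x y)

-- Induction on the construction. The order is bounded as well because `K₁` must be excluded before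
-- the upper bound applies.
InTSL⇒tight : ∀ {T} → InTSL T → IsTree T → 2 ≤ size T × Tight T
InTSL⇒tight (base (_ , inj₁ n≡2)) tree = ℕ.≤-reflexive (sym n≡2) , tight-P₂ tree n≡2
InTSL⇒tight {T} (base (_ , inj₂ (k , γ , eq))) tree with IsγLD.witness γ
... | S , ld , refl = 2≤order tree ld (ℕ.≤-trans (ℕ.m≤m+n _ (s T)) (ℕ.≤-reflexive eq)) , λ S′ ld′ → begin
    size T + ℓ T                ≡⟨ eq ⟨
    2 * count S + s T           ≤⟨ ℕ.+-monoˡ-≤ (s T) (ℕ.*-monoʳ-≤ 2 (IsγLD.minimal γ S′ ld′)) ⟩
    2 * count S′ + s T          ≤⟨ ℕ.m≤m+n _ (sl T) ⟩
    2 * count S′ + s T + sl T   ∎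
  where open ℕ.≤-Reasoning
InTSL⇒tight {T} (sl-step k 2≤k Ts vs fam sup iso) tree with fin-pair 2≤k
... | a , b , a≢b = edge⇒2≤size tree (adj-vw a)
                  , Supported.tight-join sup a b a≢b (λ i → proj₂ (InTSL⇒tight (fam i) (part-tree i)))
  where open Joined tree (join-transport (proj₁ (SL-join k Ts vs)) iso)

count-none : ∀ {n} (f : Fin n → Bool) → ¬ ∃ (λ x → f x ≡ true) → count f ≡ 0
count-none {zero}  f none = refl
count-none {suc n} f none = cong₂ _+_ (cong ind (¬-not λ p → none (zero , p)))
                                      (count-none (f ∘ suc) (λ { (x , p) → none (suc x , p) }))

-- Upper and lower bound meet at the sparse set, which is therefore of minimum size.
tight⇒base : ∀ {T} → IsTree T → 2 ≤ size T → Tight T → sl T ≡ 0 → InTSL T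
tight⇒base {T} tree 2≤n tight sl≡0 with sparse-LD tree 2≤n
... | D , ld , _ , le = base (tree , inj₂ (count D , γ , ℕ.≤-antisym
      (ℕ.≤-trans (ℕ.m≤m+n _ (sl T)) le)
      (subst (size T + ℓ T ≤_) (trans (cong (2 * count D + s T +_) sl≡0) (ℕ.+-identityʳ _)) (tight D ld))))
  where
  γ : IsγLD T (count D)
  γ = record
    { witness = D , ld , refl
    ; minimal = λ S ldS → ℕ.*-cancelˡ-≤ 2 (ℕ.+-cancelʳ-≤ (s T) _ _ (ℕ.+-cancelʳ-≤ (sl T) _ _
        (ℕ.≤-trans le (tight S ldS)))) }

-- Strong induction on the order, bounded by `N`: a support link serves as centre, and the branches
-- at it are smaller tight trees.
tight⇒InTSL : ∀ N {T} → size T ≤ N → IsTree T → 2 ≤ size T → Tight T → InTSL T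
tight⇒InTSL zero le tree 2≤n tight = case ℕ.≤-trans 2≤n le of λ ()
tight⇒InTSL (suc N) {T} le tree 2≤n tight with any? (λ w → isSupportLink T w ≟ᵇ true)
... | no none = tight⇒base tree 2≤n tight (count-none (isSupportLink T) none)
... | yes (w , link) = sl-step k 2≤k Ts vs
        (λ i → tight⇒InTSL N (ℕ.≤-pred (ℕ.≤-trans (part-size-< i) le)) (part-tree i)
          (2≤part i) (Supported.tight-part sup (proj₁ pair) (proj₁ (proj₂ pair)) (proj₂ (proj₂ pair)) tight i))
        sup (join-iso (proj₁ (SL-join k Ts vs)) join)
  where
  open Branches T tree w using (k; Ts; vs; join; w-nb; support-branch)
  open Joined tree join using (part-size-<; part-tree; module Supported)
  2≤k : 2 ≤ k
  2≤k = slink-nbrs tree 2≤n w link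
  pair : ∃₂ λ (a b : Fin k) → a ≢ b
  pair = fin-pair 2≤k
  sup : ∀ i → Support (Ts i) (vs i)
  sup i = support-branch (proj₁ (slink⁻ T w link)) i (proj₂ (proj₂ (slink⁻ T w link)) _ (w-nb i))
  2≤part : ∀ i → 2 ≤ size (Ts i)
  2≤part i with support⁻ (Ts i) (vs i) (sup i)
  ... | y , a , _ = edge⇒2≤size (part-tree i) {zero} {y} a

theorem18 : (T : Graph) → IsTree T → (k : ℕ) → IsγLD T k →
    ((2 * k + s T + sl T ≡ size T + ℓ T) ⇔ InTSL T)
theorem18 T tree k γ with IsγLD.witness γ
... | S , ld , refl = mk⇔ forward backward
  where
  open ℕ.≤-Reasoning
  forward : 2 * count S + s T + sl T ≡ size T + ℓ T → InTSL T
  forward eq = tight⇒InTSL (size T) ℕ.≤-refl tree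
    (2≤order tree ld (ℕ.≤-trans (ℕ.m≤m+n _ (s T)) (ℕ.≤-trans (ℕ.m≤m+n _ (sl T)) (ℕ.≤-reflexive eq))))
    (λ S′ ld′ → ℕ.≤-trans (ℕ.≤-reflexive (sym eq)) (weigh S′ ld′))
    where
    weigh : ∀ S′ → IsLD T S′ → 2 * count S + s T + sl T ≤ 2 * count S′ + s T + sl T
    weigh S′ ld′ = ℕ.+-monoˡ-≤ (sl T) (ℕ.+-monoˡ-≤ (s T) (ℕ.*-monoʳ-≤ 2 (IsγLD.minimal γ S′ ld′)))
  backward : InTSL T → 2 * count S + s T + sl T ≡ size T + ℓ T
  backward fam with InTSL⇒tight fam tree
  -- A sparse set bounds the minimum from above, tightness from below.
  ... | 2≤n , tight with sparse-LD tree 2≤n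
  ...   | D , ldD , _ , le = ℕ.≤-antisym
    (ℕ.≤-trans (ℕ.+-monoˡ-≤ (sl T) (ℕ.+-monoˡ-≤ (s T) (ℕ.*-monoʳ-≤ 2 (IsγLD.minimal γ D ldD)))) le)
    (tight S ld)
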